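{- The sets of patterns $\{121,1322\}$, $\{112,1232\}$ and $\{112,2132\}$ are pairwise $m$-equivalent, that is, $\{121,1322\}\sim\{112,1232\}\sim\{112,2132\}$.
   Context: A (finite, reduced) multiset is $S=1^{a_1}2^{a_2}\cdots k^{a_k}$ with $k\ge 1$ and all $a_i\ge 1$, meaning that $i$ occurs with multiplicity $a_i$. A multipermutation of $S$ is a word having exactly $a_i$ occurrences of each letter $i\in[k]=\{1,\dots,k\}$ and no other letters. A word $\pi=\pi_1\cdots\pi_n$ contains a pattern (word) $\rho=\rho_1\cdots\rho_\ell$ if there are indices $i(1)<\cdots<i(\ell)$ such that for all $a,b\in[\ell]$: $\pi_{i(a)}<\pi_{i(b)}$ iff $\rho_a<\rho_b$, and $\pi_{i(a)}>\pi_{i(b)}$ iff $\rho_a>\rho_b$; otherwise $\pi$ avoids $\rho$. For a set $P$ of patterns, $\mathrm{av}(S;P)$ is the number of multipermutations of $S$ that avoid every pattern in $P$. Two sets of patterns $P,Q$ are $m$-equivalent, written here $P\sim Q$, if $\mathrm{av}(S;P)=\mathrm{av}(S;Q)$ for every multiset $S$. -}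

module Defs where

open import Algebra.Properties.CommutativeMonoid.Sum using (sum; ∑-distrib-+; sum-cong-≗; sum-replicate-zero)
open import Data.Bool using (true; false)
open import Data.Fin as Fin using (Fin; zero; suc; toℕ)
import Data.Fin.Properties as Fin
open import Data.List using (List; []; _∷_; length; lookup; filter; applyUpTo; cartesianProductWith)
open import Data.List.Membership.Propositional using (_∈_)
open import Data.List.Membership.Propositional.Properties using (∈-filter⁺; ∈-filter⁻; ∈-applyUpTo⁺; ∈-cartesianProductWith⁺)
open import Data.List.Properties using (∷-injective)
open import Data.List.Relation.Unary.All as All using (All; []; _∷_)
open import Data.List.Relation.Unary.Any using (here)
open import Data.List.Relation.Unary.Unique.Propositional using (Unique; []; _∷_)
import Data.List.Relation.Unary.Unique.Propositional.Properties as Unique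
open import Data.Nat using (ℕ; zero; suc; _+_; _≤_; _<_; _>_; s≤s; _≟_; _≤?_; _<?_)
open import Data.Nat.Properties using (+-0-commutativeMonoid; suc-injective; <⇒≢)
open import Data.Product using (∃; _×_; _,_; proj₁; proj₂)
open import Data.Vec.Functional using (Vector; head; tail) renaming (_∷_ to _∷ᶠ_)
open import Function using (_∘_; _⇔_; mk⇔; Equivalence)
open import Relation.Binary.PropositionalEquality using (_≡_; refl; sym; trans; cong; cong₂; subst; subst₂; _≗_; module ≡-Reasoning)
open import Relation.Nullary using (Dec; does; ¬_; ¬?; _×-dec_; _→-dec_)
open import Relation.Nullary.Decidable using (map′)
open import Relation.Unary using (Decidable)

Word : Set
Word = List ℕ

-- The multiset 1^{a₁} ⋯ k^{a_k} has  mult i = a_{toℕ i + 1}.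
record Multiset : Set where
  field
    k      : ℕ
    k≥1    : 1 ≤ k
    mult   : Fin k → ℕ
    mult≥1 : ∀ i → 1 ≤ mult i

  size : ℕ
  size = sum +-0-commutativeMonoid mult

occurrences : ℕ → Word → ℕ
occurrences x w = length (filter (x ≟_) w)

InRange : ℕ → ℕ → Set
InRange k x = 1 ≤ x × x ≤ k

IsMultipermutation : Multiset → Word → Set
IsMultipermutation S w =
  All (InRange k) w × (∀ (i : Fin k) → occurrences (suc (toℕ i)) w ≡ mult i)
  where open Multiset S

isMultipermutation? : ∀ S → Decidable (IsMultipermutation S)
isMultipermutation? S w =
  All.all? (λ x → (1 ≤? x) ×-dec (x ≤? k)) w
  ×-dec Fin.all? (λ i → occurrences (suc (toℕ i)) w ≟ mult i)
  where open Multiset S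

-- The function i selects the (0-based) positions i(1) < ⋯ < i(ℓ).
IsOccurrence : (ρ π : Word) → (Fin (length ρ) → Fin (length π)) → Set
IsOccurrence ρ π i =
  (∀ a b → a Fin.< b → i a Fin.< i b)
  × (∀ a b → (lookup π (i a) < lookup π (i b) ⇔ lookup ρ a < lookup ρ b)
           × (lookup π (i a) > lookup π (i b) ⇔ lookup ρ a > lookup ρ b))

Contains : (π ρ : Word) → Set
Contains π ρ = ∃ (IsOccurrence ρ π)

Avoids : (π ρ : Word) → Set
Avoids π ρ = ¬ Contains π ρ

-- Sets of patterns are finite, given as lists; repetitions and order are
-- irrelevant to avoidance.
AvoidsAll : List Word → Word → Set
AvoidsAll P π = All (Avoids π) P

private
  _⇔-dec_ : ∀ {A B : Set} → Dec A → Dec B → Dec (A ⇔ B)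
  a? ⇔-dec b? =
    map′ (λ (f , g) → mk⇔ f g) (λ e → Equivalence.to e , Equivalence.from e)
         ((a? →-dec b?) ×-dec (b? →-dec a?))

  isOccurrence? : ∀ ρ π → Decidable (IsOccurrence ρ π)
  isOccurrence? ρ π i =
    Fin.all? (λ a → Fin.all? (λ b → (a Fin.<? b) →-dec (i a Fin.<? i b)))
    ×-dec Fin.all? (λ a → Fin.all? (λ b →
      ((lookup π (i a) <? lookup π (i b)) ⇔-dec (lookup ρ a <? lookup ρ b))
      ×-dec ((lookup π (i b) <? lookup π (i a)) ⇔-dec (lookup ρ b <? lookup ρ a))))

  isOccurrence-resp : ∀ ρ π {i j} → i ≗ j → IsOccurrence ρ π i → IsOccurrence ρ π j
  isOccurrence-resp ρ π i≗j (inc , iso) =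
      (λ a b a<b → subst₂ Fin._<_ (i≗j a) (i≗j b) (inc a b a<b))
    , (λ a b → subst₂ (λ x y → (lookup π x < lookup π y ⇔ lookup ρ a < lookup ρ b)
                             × (lookup π x > lookup π y ⇔ lookup ρ a > lookup ρ b))
                      (i≗j a) (i≗j b) (iso a b))

  anyFunction? : ∀ l {n} {Q : Vector (Fin n) l → Set} →
                 (∀ {f g} → f ≗ g → Q f → Q g) → Decidable Q → Dec (∃ Q)
  anyFunction? zero resp Q? =
    map′ (λ q → _ , q) (λ (f , q) → resp (λ ()) q) (Q? (λ ()))
  anyFunction? (suc l) resp Q? =
    map′ (λ (x , f , q) → _ , q)
         (λ (f , q) → head f , tail f , resp (λ { zero → refl ; (suc _) → refl }) q)
         (Fin.any? (λ x → anyFunction? l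
           (λ f≗g → resp (λ { zero → refl ; (suc a) → f≗g a }))
           (λ f → Q? (x ∷ᶠ f))))

contains? : ∀ π ρ → Dec (Contains π ρ)
contains? π ρ = anyFunction? (length ρ) (isOccurrence-resp ρ π) (isOccurrence? ρ π)

avoidsAll? : ∀ P → Decidable (AvoidsAll P)
avoidsAll? P π = All.all? (λ ρ → ¬? (contains? π ρ)) P

words : (k n : ℕ) → List Word
words k zero    = [] ∷ []
words k (suc n) = cartesianProductWith _∷_ (applyUpTo suc k) (words k n)

avoiders : Multiset → List Word → List Word
avoiders S P =
  filter (λ w → isMultipermutation? S w ×-dec avoidsAll? P w) (words k size)
  where open Multiset S

av : Multiset → List Word → ℕ
av S P = length (avoiders S P)

infix 4 _∼_
_∼_ : List Word → List Word → Set
P ∼ Q = ∀ S → av S P ≡ av S Q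

-- The next two facts justify reading  av S P  as the number of
-- multipermutations of S that avoid P:  avoiders S P  lists each exactly once.

private
  words-unique : ∀ k n → Unique (words k n)
  words-unique k zero    = [] ∷ []
  words-unique k (suc n) =
    Unique.cartesianProductWith⁺ _∷_ ∷-injective
      (Unique.applyUpTo⁺₁ suc k (λ i<j _ → <⇒≢ i<j ∘ suc-injective))
      (words-unique k n)

  ∈-words : ∀ k w → All (InRange k) w → w ∈ words k (length w)
  ∈-words k []      []                     = here refl
  ∈-words k (suc x ∷ w) ((_ , x<k) ∷ r) =
    ∈-cartesianProductWith⁺ _∷_ (∈-applyUpTo⁺ suc x<k) (∈-words k w r)

  ∑ : ∀ {k} → (Fin k → ℕ) → ℕ
  ∑ = sum +-0-commutativeMonoid

  indicator : ℕ → ℕ → ℕ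
  indicator x y = occurrences x (y ∷ [])

  indicator-suc : ∀ x y → indicator (suc x) (suc y) ≡ indicator x y
  indicator-suc x y with does (x ≟ y)
  ... | true  = refl
  ... | false = refl

  occurrences-∷ : ∀ x y w → occurrences x (y ∷ w) ≡ indicator x y + occurrences x w
  occurrences-∷ x y w with does (x ≟ y)
  ... | true  = refl
  ... | false = refl

  ∑-indicator : ∀ k y → y < k → ∑ {k} (λ i → indicator (toℕ i) y) ≡ 1
  ∑-indicator (suc k) zero    _         = cong suc (sum-replicate-zero +-0-commutativeMonoid k)
  ∑-indicator (suc k) (suc y) (s≤s y<k) =
    trans (sum-cong-≗ +-0-commutativeMonoid {k} (λ i → indicator-suc (toℕ i) y))
          (∑-indicator k y y<k)

  ∑-occurrences : ∀ k w → All (InRange k) w →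
                  ∑ {k} (λ i → occurrences (suc (toℕ i)) w) ≡ length w
  ∑-occurrences k []          []              = sum-replicate-zero +-0-commutativeMonoid k
  ∑-occurrences k (suc y ∷ w) ((_ , y<k) ∷ r) = begin
    ∑ {k} (λ i → occurrences (suc (toℕ i)) (suc y ∷ w))
      ≡⟨ sum-cong-≗ +-0-commutativeMonoid {k} (λ i →
           trans (occurrences-∷ (suc (toℕ i)) (suc y) w)
                 (cong (_+ occurrences (suc (toℕ i)) w) (indicator-suc (toℕ i) y))) ⟩
    ∑ {k} (λ i → indicator (toℕ i) y + occurrences (suc (toℕ i)) w)
      ≡⟨ ∑-distrib-+ +-0-commutativeMonoid {k} _ _ ⟩
    ∑ {k} (λ i → indicator (toℕ i) y) + ∑ {k} (λ i → occurrences (suc (toℕ i)) w)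
      ≡⟨ cong₂ _+_ (∑-indicator k y y<k) (∑-occurrences k w r) ⟩
    suc (length w) ∎
    where open ≡-Reasoning

avoiders-unique : ∀ S P → Unique (avoiders S P)
avoiders-unique S P =
  Unique.filter⁺ (λ w → isMultipermutation? S w ×-dec avoidsAll? P w) (words-unique k size)
  where open Multiset S

∈-avoiders : ∀ S P w → w ∈ avoiders S P ⇔ (IsMultipermutation S w × AvoidsAll P w)
∈-avoiders S P w = mk⇔
  (λ w∈ → proj₂ (∈-filter⁻ good? {xs = words k size} w∈))
  (λ good → ∈-filter⁺ good? (complete (proj₁ good)) good)
  where
  open Multiset S
  good? : Decidable (λ w → IsMultipermutation S w × AvoidsAll P w)
  good? w = isMultipermutation? S w ×-dec avoidsAll? P w
  complete : IsMultipermutation S w → w ∈ words k size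
  complete (range , occ) =
    subst (λ n → w ∈ words k n)
      (trans (sym (∑-occurrences k w range)) (sum-cong-≗ +-0-commutativeMonoid {k} occ))
      (∈-words k w range)

{-# OPTIONS --safe #-}
module Submission where

-- All three classes grow by inserting the copies of a new smallest letter c, of
-- multiplicity a, at a split (u , v) of a word in larger letters:  u cᵃ v  for
-- {121, 1322},  u c v cᵃ⁻¹  for the other two.  The result is again in the class
-- exactly when the split is active, which means respectively that v avoids 211,
-- that v avoids 121, or that no x occurs in u while y x, with y > x, occurs in v.
-- If a word has N active splits, then its N children have N + 1 active splits each
-- when a = 1, and a + 1, …, a + N of them in some order when a ≥ 2.  So the three
-- classes have the same generating tree.

open import Defs
open import Data.Bool using (true; false)
open import Data.Fin as Fin using (Fin; zero; suc; toℕ; #_)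
open import Data.List using (List; []; _∷_; _++_; length; lookup; map; filter; replicate; concatMap; tabulate; drop; applyDownFrom; applyUpTo; downFrom)
open import Data.List.Membership.Propositional using (_∈_; _∉_; find; lose)
open import Data.List.Membership.Propositional.Properties using (∈-map⁺; ∈-map⁻; ∈-++⁺ˡ; ∈-++⁺ʳ; ∈-++⁻; ∈-concatMap⁻; ∈-concatMap⁺; ∈-filter⁺; ∈-filter⁻; ∈-lookup)
open import Data.List.Membership.Propositional.Properties.WithK using (unique∧set⇒bag)
open import Data.List.Properties
open import Data.List.Relation.Binary.BagAndSetEquality using (∼bag⇒↭; ↭⇒∼bag; >>=-cong)
open import Data.List.Relation.Binary.Disjoint.Propositional using (Disjoint)
open import Data.List.Relation.Binary.Permutation.Propositional using (_↭_; refl; prep; swap; ↭-trans; ↭-refl; ↭-reflexive; module PermutationReasoning)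
open import Data.List.Relation.Binary.Permutation.Propositional.Properties using (map⁺; ∷↭∷ʳ; ++⁺; filter-↭; ↭-length; ↭-reverse)
open import Data.List.Relation.Binary.Sublist.Propositional using (_⊆_; []; _∷_; _∷ʳ_; minimum; from∈; ⊆-refl; ⊆-trans) renaming (lookup to ∈-resp-⊆)
open import Data.List.Relation.Binary.Sublist.Propositional.Properties using (∷ˡ⁻; ∷⁻; ++⁺ˡ; ++⁺ʳ; All-resp-⊆; filter-⊆) renaming (++⁺ to ⊆-++⁺; filter⁺ to ⊆-filter⁺)
open import Data.List.Relation.Unary.All as All using (All; []; _∷_)
import Data.List.Relation.Unary.All.Properties as All
open import Data.List.Relation.Unary.AllPairs using ([]; _∷_)
open import Data.List.Relation.Unary.Any using (here; there)
open import Data.List.Relation.Unary.Unique.Propositional using (Unique)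
import Data.List.Relation.Unary.Unique.Propositional.Properties as Unique
open import Data.Nat
open import Data.Nat.Properties
open import Data.List.Relation.Binary.Sublist.DecPropositional _≟_ using (_⊆?_)
open import Data.Product using (∃; ∃₂; _×_; _,_; proj₁; proj₂; map₁)
open import Data.Sum using (_⊎_; inj₁; inj₂; [_,_]′)
open import Function using (_∘_; _⇔_; mk⇔; Equivalence; id)
open import Function.Properties.Inverse using (↔-refl)
open import Level using (Level)
open import Relation.Binary.Definitions using (tri<; tri≈; tri>)
open import Relation.Binary.PropositionalEquality
open import Relation.Nullary
open import Relation.Nullary.Decidable using (map′; toWitness)
open import Relation.Unary using (Pred; Decidable)

-- Avoiding the short pattern leaves one choice, the place of the first `c`: 121 forbids a larger
-- letter between two copies, 112 forbids one after the second copy. Activity is what remains of the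
-- long pattern when `c` plays its 1; every other occurrence lies in the parent. A lone `c` takes
-- part in no obstruction to activity, but the cut that receives it becomes two cuts, whence N + 1.
-- Repeated copies do matter. In `u cᵃ v` a letter of `u` followed by two copies is a 211, so 1 + a
-- + |v| cuts survive, with |v| = 0, ..., N - 1. In `u c v cᵃ⁻¹` with 121 as obstruction, a letter
-- of `v` between copies kills every cut before the first `c` and leaves a + |v|; for empty `v`
-- nothing is lost and the count is a + N. Under the third criterion the cuts in `u` keep their
-- status and a more come from the final copies, so the count is a plus the ordinal of the split
-- among the active ones. These values come in different orders, so the classes are compared through
-- lists of labels up to permutation, with no explicit bijection of words.

private variable
  ℓ : Level
  A B : Set ℓ

-- Pattern containment as a sublist relation

pick : ∀ {t} (π : Word) d p → d ≤ toℕ p → t ⊆ drop (suc (toℕ p)) π → lookup π p ∷ t ⊆ drop d π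
pick (x ∷ π) zero    zero    _       s = refl ∷ s
pick (x ∷ π) zero    (suc p) _       s = x ∷ʳ pick π zero p z≤n s
pick (x ∷ π) (suc d) (suc p) (s≤s h) s = pick π d p h s

-- Each chosen position bounds the later ones from below, so the induction on `ℓ` carries a lower
-- bound `d` and looks only at the part of `π` past it.
tabulate-⊆-drop : ∀ {ℓ} (π : Word) d (i : Fin ℓ → Fin (length π)) →
                  (∀ a b → a Fin.< b → i a Fin.< i b) → (∀ a → d ≤ toℕ (i a)) →
                  tabulate (lookup π ∘ i) ⊆ drop d π
tabulate-⊆-drop {zero}  π d i inc bound = minimum _
tabulate-⊆-drop {suc ℓ} π d i inc bound =
  pick π d (i zero) (bound zero)
    (tabulate-⊆-drop π (suc (toℕ (i zero))) (i ∘ suc)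
      (λ a b a<b → inc (suc a) (suc b) (s≤s a<b))
      (λ a → inc zero (suc a) z<s))

letters-⊆ : ∀ {ℓ} (π : Word) (i : Fin ℓ → Fin (length π)) → (∀ a b → a Fin.< b → i a Fin.< i b) →
            tabulate (lookup π ∘ i) ⊆ π
letters-⊆ π i inc = tabulate-⊆-drop π 0 i inc (λ _ → z≤n)

module _ (f : ℕ → ℕ) where

  -- A sublist derivation records which positions are kept; they are read off here.
  embed : ∀ ρ {π} → map f ρ ⊆ π → Fin (length ρ) → Fin (length π)
  embed (r ∷ ρ) (_ ∷ʳ s) a       = suc (embed (r ∷ ρ) s a)
  embed (_ ∷ ρ) (_ ∷ s)  zero    = zero
  embed (_ ∷ ρ) (_ ∷ s)  (suc a) = suc (embed ρ s a)

  embed-mono : ∀ ρ {π} (s : map f ρ ⊆ π) a b → a Fin.< b → embed ρ s a Fin.< embed ρ s b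
  embed-mono (r ∷ ρ) (_ ∷ʳ s) a       b       a<b       = s≤s (embed-mono (r ∷ ρ) s a b a<b)
  embed-mono (_ ∷ ρ) (_ ∷ s)  zero    (suc b) _         = z<s
  embed-mono (_ ∷ ρ) (_ ∷ s)  (suc a) (suc b) (s≤s a<b) = s≤s (embed-mono ρ s a b a<b)

  lookup-embed : ∀ ρ {π} (s : map f ρ ⊆ π) a → lookup π (embed ρ s a) ≡ f (lookup ρ a)
  lookup-embed (r ∷ ρ) (_ ∷ʳ s) a       = lookup-embed (r ∷ ρ) s a
  lookup-embed (_ ∷ ρ) (e ∷ s)  zero    = sym e
  lookup-embed (_ ∷ ρ) (_ ∷ s)  (suc a) = lookup-embed ρ s a

  module _ (mono : ∀ {m n} → 1 ≤ m → m < n → f m < f n) where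

    f-<⇔ : ∀ {m n} → 1 ≤ m → 1 ≤ n → f m < f n ⇔ m < n
    f-<⇔ {m} {n} 1≤m 1≤n = mk⇔ reflects (mono 1≤m)
      where
      reflects : f m < f n → m < n
      reflects fm<fn with <-cmp m n
      ... | tri< m<n _ _    = m<n
      ... | tri≈ _ refl _   = contradiction fm<fn (<-irrefl refl)
      ... | tri> _ _ n<m    = contradiction fm<fn (<-asym (mono 1≤n n<m))

    ⊆⇒Contains : ∀ ρ {π} → All (1 ≤_) ρ → map f ρ ⊆ π → Contains π ρ
    ⊆⇒Contains ρ {π} pos s = embed ρ s , embed-mono ρ s , λ a b → iff a b , iff b a
      where
      at : ∀ a → 1 ≤ lookup ρ a
      at a = All.lookup pos (∈-lookup a)
      iff : ∀ a b → lookup π (embed ρ s a) < lookup π (embed ρ s b) ⇔ lookup ρ a < lookup ρ b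
      iff a b rewrite lookup-embed ρ s a | lookup-embed ρ s b = f-<⇔ (at a) (at b)

-- Patterns have positive letters, so the value at 0 is junk; beyond 3 it only has to be increasing.
assign : (x y z : ℕ) → ℕ → ℕ
assign x y z 0             = 0
assign x y z 1             = x
assign x y z 2             = y
assign x y z (suc (suc (suc n))) = n + z

assign-mono : ∀ {x y z} → x < y → y < z → ∀ {m n} → 1 ≤ m → m < n → assign x y z m < assign x y z n
assign-mono x<y y<z {1} {1} _ (s≤s ())
assign-mono x<y y<z {1} {2} _ _ = x<y
assign-mono x<y y<z {1} {suc (suc (suc n))} _ _ = <-≤-trans (<-trans x<y y<z) (m≤n+m _ n)
assign-mono x<y y<z {2} {1} _ (s≤s ())
assign-mono x<y y<z {2} {2} _ (s≤s (s≤s ()))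
assign-mono x<y y<z {2} {suc (suc (suc n))} _ _ = <-≤-trans y<z (m≤n+m _ n)
assign-mono x<y y<z {suc (suc (suc m))} {suc (suc (suc n))} _ (s≤s (s≤s (s≤s m<n))) = +-monoˡ-< _ m<n
assign-mono x<y y<z {suc (suc (suc m))} {1} _ (s≤s ())
assign-mono x<y y<z {suc (suc (suc m))} {2} _ (s≤s (s≤s ()))

module Occurrence {ρ π : Word} (occ : Contains π ρ) where

  private
    i   = proj₁ occ
    iso = proj₂ (proj₂ occ)

  at : Fin (length ρ) → ℕ
  at a = lookup π (i a)

  letters : tabulate at ⊆ π
  letters = letters-⊆ π i (proj₁ (proj₂ occ))

  at-< : ∀ a b → lookup ρ a < lookup ρ b → at a < at b
  at-< a b = Equivalence.from (proj₁ (iso a b))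

  at-≡ : ∀ a b → lookup ρ a ≡ lookup ρ b → at a ≡ at b
  at-≡ a b eq with <-cmp (at a) (at b)
  ... | tri< lt _ _ = contradiction (Equivalence.to (proj₁ (iso a b)) lt) (<-irrefl eq)
  ... | tri≈ _ e _  = e
  ... | tri> _ _ gt = contradiction (Equivalence.to (proj₂ (iso a b)) gt) (<-irrefl (sym eq))

-- A pattern with two or three values is given by all its instances on actual letters, so that
-- avoidance speaks of sublists and not of position functions.
Free₂ : (ℕ → ℕ → Word) → Word → Set
Free₂ p w = ∀ {x y} → x < y → ¬ (p x y ⊆ w)

Free₃ : (ℕ → ℕ → ℕ → Word) → Word → Set
Free₃ p w = ∀ {x y z} → x < y → y < z → ¬ (p x y z ⊆ w)

-- The value `suc y` is just a number above `y`, which keeps `assign` increasing. For a literal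
-- pattern the `map` computes to the family used in `121-free` and the like.
avoids⇒free₂ : ∀ ρ {w} {pos : True (All.all? (1 ≤?_) ρ)} →
               Avoids w ρ → Free₂ (λ x y → map (assign x y (suc y)) ρ) w
avoids⇒free₂ ρ {pos = pos} av x<y s = av (⊆⇒Contains _ (assign-mono x<y ≤-refl) ρ (toWitness pos) s)

avoids⇒free₃ : ∀ ρ {w} {pos : True (All.all? (1 ≤?_) ρ)} →
               Avoids w ρ → Free₃ (λ x y z → map (assign x y z) ρ) w
avoids⇒free₃ ρ {pos = pos} av x<y y<z s = av (⊆⇒Contains _ (assign-mono x<y y<z) ρ (toWitness pos) s)

121-free 112-free : Word → Set
121-free = Free₂ (λ x y → x ∷ y ∷ x ∷ [])
112-free = Free₂ (λ x y → x ∷ x ∷ y ∷ [])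

1322-free 1232-free 2132-free : Word → Set
1322-free = Free₃ (λ x y z → x ∷ z ∷ y ∷ y ∷ [])
1232-free = Free₃ (λ x y z → x ∷ y ∷ z ∷ y ∷ [])
2132-free = Free₃ (λ x y z → y ∷ x ∷ z ∷ y ∷ [])

free⇒avoids-121 : ∀ {w} → 121-free w → Avoids w (1 ∷ 2 ∷ 1 ∷ [])
free⇒avoids-121 {w} free occ =
  free (at-< (# 0) (# 1) ≤-refl)
       (subst (λ l → at (# 0) ∷ at (# 1) ∷ l ∷ [] ⊆ w) (at-≡ (# 2) (# 0) refl) letters)
  where open Occurrence {π = w} occ

free⇒avoids-112 : ∀ {w} → 112-free w → Avoids w (1 ∷ 1 ∷ 2 ∷ [])
free⇒avoids-112 {w} free occ =
  free (at-< (# 0) (# 2) ≤-refl)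
       (subst (λ l → at (# 0) ∷ l ∷ at (# 2) ∷ [] ⊆ w) (at-≡ (# 1) (# 0) refl) letters)
  where open Occurrence {π = w} occ

free⇒avoids-1322 : ∀ {w} → 1322-free w → Avoids w (1 ∷ 3 ∷ 2 ∷ 2 ∷ [])
free⇒avoids-1322 {w} free occ =
  free (at-< (# 0) (# 2) ≤-refl) (at-< (# 2) (# 1) ≤-refl)
       (subst (λ l → at (# 0) ∷ at (# 1) ∷ at (# 2) ∷ l ∷ [] ⊆ w) (at-≡ (# 3) (# 2) refl) letters)
  where open Occurrence {π = w} occ

free⇒avoids-1232 : ∀ {w} → 1232-free w → Avoids w (1 ∷ 2 ∷ 3 ∷ 2 ∷ [])
free⇒avoids-1232 {w} free occ =
  free (at-< (# 0) (# 1) ≤-refl) (at-< (# 1) (# 2) ≤-refl)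
       (subst (λ l → at (# 0) ∷ at (# 1) ∷ at (# 2) ∷ l ∷ [] ⊆ w) (at-≡ (# 3) (# 1) refl) letters)
  where open Occurrence {π = w} occ

free⇒avoids-2132 : ∀ {w} → 2132-free w → Avoids w (2 ∷ 1 ∷ 3 ∷ 2 ∷ [])
free⇒avoids-2132 {w} free occ =
  free (at-< (# 1) (# 0) ≤-refl) (at-< (# 0) (# 2) ≤-refl)
       (subst (λ l → at (# 0) ∷ at (# 1) ∷ at (# 2) ∷ l ∷ [] ⊆ w) (at-≡ (# 3) (# 0) refl) letters)
  where open Occurrence {π = w} occ

-- Counting

filter-map : (f : A → B) {P : Pred B ℓ} (P? : Decidable P) → ∀ xs →
             filter P? (map f xs) ≡ map f (filter (P? ∘ f) xs)
filter-map f P? []       = refl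
filter-map f P? (x ∷ xs) with does (P? (f x))
... | true  = cong (f x ∷_) (filter-map f P? xs)
... | false = filter-map f P? xs

count : {P : Pred A ℓ} → Decidable P → List A → ℕ
count P? xs = length (filter P? xs)

module _ {P : Pred A ℓ} (P? : Decidable P) where

  count-++ : ∀ xs ys → count P? (xs ++ ys) ≡ count P? xs + count P? ys
  count-++ xs ys = trans (cong length (filter-++ P? xs ys)) (length-++ (filter P? xs))

  count-↭ : ∀ {xs ys} → xs ↭ ys → count P? xs ≡ count P? ys
  count-↭ p = ↭-length (filter-↭ P? p)

  count-all : ∀ {xs} → All P xs → count P? xs ≡ length xs
  count-all ps = cong length (filter-all P? ps)

  count-none : ∀ {xs} → All (¬_ ∘ P) xs → count P? xs ≡ 0
  count-none ps = cong length (filter-none P? ps)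

  count-map : (f : B → A) → ∀ xs → count P? (map f xs) ≡ count (P? ∘ f) xs
  count-map f xs = trans (cong length (filter-map f P? xs)) (length-map f (filter (P? ∘ f) xs))

  count-map-cong : {f g : B → A} → ∀ {xs} → All (λ x → P (f x) ⇔ P (g x)) xs →
                   count P? (map f xs) ≡ count P? (map g xs)
  count-map-cong [] = refl
  count-map-cong {f = f} {g} {x ∷ _} (e ∷ es) with P? (f x) | P? (g x)
  ... | true  because _ | true  because _ = cong suc (count-map-cong es)
  ... | false because _ | false because _ = count-map-cong es
  ... | yes p           | no ¬q           = contradiction (Equivalence.to e p) ¬q
  ... | no ¬p           | yes q           = contradiction (Equivalence.from e q) ¬p

-- Splits of a word

Split : Set
Split = Word × Word

splits : Word → List Split
splits []      = ([] , []) ∷ []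
splits (x ∷ w) = ([] , x ∷ w) ∷ map (map₁ (x ∷_)) (splits w)

before : Word → Split → Split
before s (p , q) = p , q ++ s

after : Word → Split → Split
after u (p , q) = u ++ p , q

∈-splits⁻ : ∀ w {u v} → (u , v) ∈ splits w → u ++ v ≡ w
∈-splits⁻ []      (here refl) = refl
∈-splits⁻ (x ∷ w) (here refl) = refl
∈-splits⁻ (x ∷ w) (there s) with _ , s′ , refl ← ∈-map⁻ _ s = cong (x ∷_) (∈-splits⁻ w s′)

∈-splits⁺ : ∀ u v → (u , v) ∈ splits (u ++ v)
∈-splits⁺ []      []      = here refl
∈-splits⁺ []      (x ∷ v) = here refl
∈-splits⁺ (x ∷ u) v       = there (∈-map⁺ _ (∈-splits⁺ u v))

splits-All : ∀ {P : Pred Split ℓ} w → (∀ u v → u ++ v ≡ w → P (u , v)) → All P (splits w)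
splits-All w h = All.tabulate (λ {(u , v)} s → h u v (∈-splits⁻ w s))

length-splits : ∀ w → length (splits w) ≡ suc (length w)
length-splits []      = refl
length-splits (x ∷ w) = cong suc (trans (length-map _ (splits w)) (length-splits w))

-- A cut lies either before `x`, hence within `u`, or after it, hence within `s`.
splits-++-∷ : ∀ u x s → splits (u ++ x ∷ s) ≡
              map (before (x ∷ s)) (splits u) ++ map (after (u ++ x ∷ [])) (splits s)
splits-++-∷ []      x s = refl
splits-++-∷ (y ∷ u) x s = cong (([] , y ∷ u ++ x ∷ s) ∷_) (begin
  map (map₁ (y ∷_)) (splits (u ++ x ∷ s))
    ≡⟨ cong (map _) (splits-++-∷ u x s) ⟩
  map (map₁ (y ∷_)) (map (before (x ∷ s)) (splits u) ++ map (after (u ++ x ∷ [])) (splits s))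
    ≡⟨ map-++ _ (map _ (splits u)) _ ⟩
  map (map₁ (y ∷_)) (map (before (x ∷ s)) (splits u)) ++ map (map₁ (y ∷_)) (map (after (u ++ x ∷ [])) (splits s))
    ≡⟨ cong₂ _++_ (trans (sym (map-∘ (splits u))) (map-∘ (splits u))) (sym (map-∘ (splits s))) ⟩
  map (before (x ∷ s)) (map (map₁ (y ∷_)) (splits u)) ++ map (after (y ∷ u ++ x ∷ [])) (splits s) ∎)
  where open ≡-Reasoning

-- The cut between `u` and `v` arises both as the last cut of `u` and as the first cut of `v`. This
-- duplicate is the extra active split gained by a single new letter.
splits-junction : ∀ u v → map (before v) (splits u) ++ map (after u) (splits v) ↭ (u , v) ∷ splits (u ++ v)
splits-junction []      v = prep _ (↭-reflexive (map-id (splits v)))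
splits-junction (x ∷ u) v = begin
  ([] , x ∷ u ++ v) ∷ map (before v) (map (map₁ (x ∷_)) (splits u)) ++ map (after (x ∷ u)) (splits v)
    ≡⟨ cong (([] , x ∷ u ++ v) ∷_)
         (cong₂ _++_ (trans (sym (map-∘ (splits u))) (map-∘ (splits u))) (map-∘ (splits v))) ⟩
  ([] , x ∷ u ++ v) ∷ map (map₁ (x ∷_)) (map (before v) (splits u)) ++ map (map₁ (x ∷_)) (map (after u) (splits v))
    ≡⟨ cong (([] , x ∷ u ++ v) ∷_) (sym (map-++ _ (map _ (splits u)) _)) ⟩
  ([] , x ∷ u ++ v) ∷ map (map₁ (x ∷_)) (map (before v) (splits u) ++ map (after u) (splits v))
    ↭⟨ prep _ (map⁺ _ (splits-junction u v)) ⟩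
  ([] , x ∷ u ++ v) ∷ (x ∷ u , v) ∷ map (map₁ (x ∷_)) (splits (u ++ v))
    ↭⟨ swap _ _ refl ⟩
  (x ∷ u , v) ∷ ([] , x ∷ u ++ v) ∷ map (map₁ (x ∷_)) (splits (u ++ v)) ∎
  where open PermutationReasoning

-- Active splits and their ranks

activeSites : {P : Pred Split ℓ} → Decidable P → Word → ℕ
activeSites P? w = count P? (splits w)

leftRank : {P : Pred Split ℓ} → Decidable P → Split → ℕ
leftRank P? (u , v) = count P? (map (before v) (splits u))

-- The rank of an active split counts the active cuts up to and including its own, so it is its
-- ordinal from the left. No closure property of `P` is assumed, as the criterion for {112, 2132}
-- depends on both halves.
leftRanks : {P : Pred Split ℓ} (P? : Decidable P) → ∀ w →
            map (leftRank P?) (filter P? (splits w)) ≡ applyUpTo suc (activeSites P? w)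
leftRanks P? [] with P? ([] , [])
... | no _  = refl
... | yes p = cong (_∷ []) (count-all P? (p ∷ []))
leftRanks P? (x ∷ w) = byHead
  where
  consˡ : Split → Split
  consˡ = map₁ (x ∷_)
  whole = ([] , x ∷ w)
  -- This is 1 or 0 according to whether the cut in front of `x` is active, and it shifts all later
  -- ranks.
  k     = count P? (whole ∷ [])

  rank-cons : ∀ u v → u ++ v ≡ w → leftRank P? (x ∷ u , v) ≡ k + leftRank (P? ∘ consˡ) (u , v)
  rank-cons u v refl = begin
    count P? (whole ∷ map (before v) (map consˡ (splits u)))
      ≡⟨ count-++ P? (whole ∷ []) (map (before v) (map consˡ (splits u))) ⟩
    k + count P? (map (before v) (map consˡ (splits u)))
      ≡⟨ cong (λ l → k + count P? l) (trans (sym (map-∘ (splits u))) (map-∘ (splits u))) ⟩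
    k + count P? (map consˡ (map (before v) (splits u)))
      ≡⟨ cong (k +_) (count-map P? consˡ (map (before v) (splits u))) ⟩
    k + leftRank (P? ∘ consˡ) (u , v) ∎
    where open ≡-Reasoning

  tail-ranks : map (leftRank P?) (filter P? (map consˡ (splits w))) ≡
               applyUpTo (λ n → k + suc n) (count P? (map consˡ (splits w)))
  tail-ranks = begin
    map (leftRank P?) (filter P? (map consˡ (splits w)))
      ≡⟨ cong (map _) (filter-map consˡ P? (splits w)) ⟩
    map (leftRank P?) (map consˡ (filter (P? ∘ consˡ) (splits w)))
      ≡⟨ map-∘ _ ⟨
    map (leftRank P? ∘ consˡ) (filter (P? ∘ consˡ) (splits w))
      ≡⟨ map-cong-local (All.filter⁺ (P? ∘ consˡ) (splits-All w rank-cons)) ⟩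
    map (λ s → k + leftRank (P? ∘ consˡ) s) (filter (P? ∘ consˡ) (splits w))
      ≡⟨ map-∘ _ ⟩
    map (k +_) (map (leftRank (P? ∘ consˡ)) (filter (P? ∘ consˡ) (splits w)))
      ≡⟨ cong (map (k +_)) (leftRanks (P? ∘ consˡ) w) ⟩
    map (k +_) (applyUpTo suc (activeSites (P? ∘ consˡ) w))
      ≡⟨ map-applyUpTo suc (k +_) _ ⟩
    applyUpTo (λ n → k + suc n) (activeSites (P? ∘ consˡ) w)
      ≡⟨ cong (applyUpTo _) (count-map P? consˡ (splits w)) ⟨
    applyUpTo (λ n → k + suc n) (count P? (map consˡ (splits w))) ∎
    where open ≡-Reasoning

  shift-ranks : ∀ {j} → k ≡ j → map (leftRank P?) (filter P? (map consˡ (splits w))) ≡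
                applyUpTo (λ n → j + suc n) (count P? (map consˡ (splits w)))
  shift-ranks refl = tail-ranks

  byHead : map (leftRank P?) (filter P? (splits (x ∷ w))) ≡ applyUpTo suc (activeSites P? (x ∷ w))
  byHead with P? whole
  ... | yes p = cong₂ _∷_ (count-all P? (p ∷ [])) (shift-ranks (count-all P? (p ∷ [])))
  ... | no ¬p = shift-ranks (count-none P? (¬p ∷ []))

module _ {P : Pred Word ℓ} (P? : Decidable P) (P-tail : ∀ {x w} → P (x ∷ w) → P w) where

  suffix-closed : ∀ u {v} → P (u ++ v) → P v
  suffix-closed []      p = p
  suffix-closed (x ∷ u) p = suffix-closed u (P-tail p)

  all-active : ∀ w → P w → All (P ∘ proj₂) (splits w)
  all-active w p = splits-All w (λ { u v refl → suffix-closed u p })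

  -- Since `P` passes to suffixes, the suffixes with `P` are exactly the shortest ones, and their
  -- number determines their lengths.
  suffixLengths : ∀ w → map (length ∘ proj₂) (filter (P? ∘ proj₂) (splits w)) ≡
                  downFrom (activeSites (P? ∘ proj₂) w)
  suffixLengths []      with P? []
  ... | yes _ = refl
  ... | no  _ = refl
  suffixLengths (x ∷ w) = byHead
    where
    Q? = P? ∘ proj₂ {A = Word}
    consˡ : Split → Split
    consˡ = map₁ (x ∷_)

    tail-lengths : map (length ∘ proj₂) (filter Q? (map consˡ (splits w))) ≡
                   downFrom (count Q? (map consˡ (splits w)))
    tail-lengths = begin
      map (length ∘ proj₂) (filter Q? (map consˡ (splits w)))
        ≡⟨ cong (map _) (filter-map consˡ Q? (splits w)) ⟩
      map (length ∘ proj₂) (map consˡ (filter Q? (splits w)))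
        ≡⟨ map-∘ _ ⟨
      map (length ∘ proj₂) (filter Q? (splits w))
        ≡⟨ suffixLengths w ⟩
      downFrom (activeSites Q? w)
        ≡⟨ cong downFrom (count-map Q? consˡ (splits w)) ⟨
      downFrom (count Q? (map consˡ (splits w))) ∎
      where open ≡-Reasoning

    byHead : map (length ∘ proj₂) (filter Q? (splits (x ∷ w))) ≡ downFrom (activeSites Q? (x ∷ w))
    byHead with P? (x ∷ w)
    ... | no  _ = tail-lengths
    -- Here all suffixes of `w` have `P`, and `w` has as many splits as `x ∷ w` has letters.
    ... | yes p = cong₂ _∷_
        (sym (trans (count-map Q? consˡ (splits w))
             (trans (count-all Q? (all-active w (P-tail p))) (length-splits w))))
        tail-lengths

-- Duplicate-free lists and concatenation

Unique-map : {f : A → B} → ∀ {xs} → (∀ {x y} → x ∈ xs → y ∈ xs → f x ≡ f y → x ≡ y) →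
             Unique xs → Unique (map f xs)
Unique-map inj []       = []
Unique-map inj (x∉ ∷ u) =
  All.map⁺ (All.tabulate (λ y∈ eq → All.lookup x∉ y∈ (inj (here refl) (there y∈) eq)))
  ∷ Unique-map (λ x∈ y∈ → inj (there x∈) (there y∈)) u

-- An element determines, through `parent`, the list it came from, so different lists are disjoint.
-- Later `parent` deletes the smallest letter.
Unique-concatMap : {f : A → List B} (parent : B → A) → ∀ {xs} → Unique xs →
                   All (Unique ∘ f) xs → All (λ x → All (λ y → parent y ≡ x) (f x)) xs →
                   Unique (concatMap f xs)
Unique-concatMap parent [] [] [] = []
Unique-concatMap {f = f} parent {x ∷ xs} (x∉ ∷ u) (v ∷ vs) (e ∷ es) =
  Unique.++⁺ v (Unique-concatMap parent u vs es) disjoint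
  where
  disjoint : Disjoint (f x) (concatMap f xs)
  disjoint (y∈fx , y∈) with z , z∈ , y∈fz ← find (∈-concatMap⁻ f {xs = xs} y∈) =
    All.lookup x∉ z∈ (trans (sym (All.lookup e y∈fx)) (All.lookup (All.lookup es z∈) y∈fz))

concatMap-↭ : {f g : A → List B} → ∀ {xs} → All (λ x → f x ↭ g x) xs → concatMap f xs ↭ concatMap g xs
concatMap-↭ []       = ↭-refl
concatMap-↭ (p ∷ ps) = ++⁺ p (concatMap-↭ ps)

map-constant : {f : A → B} → ∀ {y xs} → All (λ x → f x ≡ y) xs → map f xs ≡ replicate (length xs) y
map-constant []       = refl
map-constant (e ∷ es) = cong₂ _∷_ e (map-constant es)

splits-unique : ∀ w → Unique (splits w)
splits-unique []      = [] ∷ []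
splits-unique (x ∷ w) =
  All.map⁺ (All.universal (λ _ ()) (splits w)) ∷ Unique.map⁺ (λ { refl → refl }) (splits-unique w)

-- Deleting a letter

Above : ℕ → Word → Set
Above c = All (c <_)

other? : ∀ c → Decidable (c ≢_)
other? c x = ¬? (c ≟ x)

delete : ℕ → Word → Word
delete c = filter (other? c)

delete-above : ∀ {c w} → Above c w → delete c w ≡ w
delete-above above = filter-all (other? _) (All.map <⇒≢ above)

delete-replicate : ∀ c m → delete c (replicate m c) ≡ []
delete-replicate c m = filter-none (other? c) (All.replicate⁺ m (λ c≢c → c≢c refl))

delete-++ : ∀ c u v → delete c (u ++ v) ≡ delete c u ++ delete c v
delete-++ c = filter-++ (other? c)

delete-∷ : ∀ c w → delete c (c ∷ w) ≡ delete c w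
delete-∷ c w = filter-reject (other? c) (λ c≢c → c≢c refl)

All-delete : ∀ {P : Pred ℕ ℓ} c {w} → All P w → All P (delete c w)
All-delete c = All.filter⁺ (other? c)

above-delete : ∀ {c w} → All (c ≤_) w → Above c (delete c w)
above-delete {c} {w} ≥c = All.zipWith (λ (c≤x , c≢x) → ≤∧≢⇒< c≤x c≢x)
  (All-delete c ≥c , All.all-filter (other? c) w)

occurrences-++ : ∀ c u v → occurrences c (u ++ v) ≡ occurrences c u + occurrences c v
occurrences-++ c = count-++ (c ≟_)

occurrences-here : ∀ c w → occurrences c (c ∷ w) ≡ suc (occurrences c w)
occurrences-here c w = cong length (filter-accept (c ≟_) refl)

occurrences-there : ∀ {c x} → c ≢ x → ∀ w → occurrences c (x ∷ w) ≡ occurrences c w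
occurrences-there c≢x w = cong length (filter-reject (_ ≟_) c≢x)

occurrences-above : ∀ {c w} → Above c w → occurrences c w ≡ 0
occurrences-above above = count-none (_ ≟_) (All.map <⇒≢ above)

occurrences-replicate : ∀ c m → occurrences c (replicate m c) ≡ m
occurrences-replicate c m = trans (count-all (c ≟_) (All.replicate⁺ m refl)) (length-replicate m)

occurrences-delete : ∀ {c x} → c ≢ x → ∀ w → occurrences x (delete c w) ≡ occurrences x w
occurrences-delete c≢x []      = refl
occurrences-delete {c} {x} c≢x (y ∷ w) with c ≟ y
... | yes refl = begin
  occurrences x (delete c (c ∷ w))  ≡⟨ cong (occurrences x) (delete-∷ c w) ⟩
  occurrences x (delete c w)        ≡⟨ occurrences-delete c≢x w ⟩
  occurrences x w                   ≡⟨ occurrences-there (c≢x ∘ sym) w ⟨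
  occurrences x (c ∷ w)             ∎
  where open ≡-Reasoning
... | no c≢y = begin
  occurrences x (delete c (y ∷ w))                    ≡⟨ cong (occurrences x) (filter-accept (other? c) c≢y) ⟩
  occurrences x (y ∷ delete c w)                      ≡⟨ occurrences-++ x (y ∷ []) (delete c w) ⟩
  occurrences x (y ∷ []) + occurrences x (delete c w) ≡⟨ cong (_ +_) (occurrences-delete c≢x w) ⟩
  occurrences x (y ∷ []) + occurrences x w            ≡⟨ occurrences-++ x (y ∷ []) w ⟨
  occurrences x (y ∷ w)                               ∎
  where open ≡-Reasoning

-- The first `c` marks where the prefix ends; hence a child determines its split.
split-at-first : ∀ {c u u′ s s′} → Above c u → Above c u′ → u ++ c ∷ s ≡ u′ ++ c ∷ s′ → u ≡ u′
split-at-first []        []         eq   = refl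
split-at-first []        (c<c ∷ _)  refl = contradiction c<c (<-irrefl refl)
split-at-first (c<c ∷ _) []         refl = contradiction c<c (<-irrefl refl)
split-at-first (_ ∷ a)   (_ ∷ a′)   eq   =
  cong₂ _∷_ (∷-injectiveˡ eq) (split-at-first a a′ (∷-injectiveʳ eq))

above-split : ∀ {c w u v} → Above c w → u ++ v ≡ w → Above c u × Above c v
above-split above refl = All.++⁻ _ above

-- The first copy of `c` always goes at the cut, which keeps the cut recoverable. Only the place of
-- the `m` further copies relative to `v` varies.
record Insertion : Set₁ where
  field
    rest             : ℕ → ℕ → Word → Word
    All-rest         : ∀ {P : Pred ℕ _} {c v} m → P c → All P v → All P (rest c m v)
    delete-rest      : ∀ {c v} m → Above c v → delete c (rest c m v) ≡ v
    occurrences-rest : ∀ {c v} m → Above c v → occurrences c (rest c m v) ≡ m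

  child : ℕ → ℕ → Split → Word
  child c m (u , v) = u ++ c ∷ rest c m v

  child-≥ : ∀ {c u v} m → Above c u → Above c v → All (c ≤_) (child c m (u , v))
  child-≥ m above-u above-v = All.++⁺ (All.map <⇒≤ above-u)
    (≤-refl ∷ All-rest m ≤-refl (All.map <⇒≤ above-v))

  delete-child : ∀ {c u v} m → Above c u → Above c v → delete c (child c m (u , v)) ≡ u ++ v
  delete-child {c} {u} {v} m above-u above-v = trans (delete-++ c u _)
    (cong₂ _++_ (delete-above above-u) (trans (delete-∷ c _) (delete-rest m above-v)))

  occurrences-child : ∀ {c u v} m → Above c u → Above c v → occurrences c (child c m (u , v)) ≡ suc m
  occurrences-child {c} {u} m above-u above-v = trans (occurrences-++ c u _)
    (cong₂ _+_ (occurrences-above above-u)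
      (trans (occurrences-here c _) (cong suc (occurrences-rest m above-v))))

-- Generating trees

-- Nodes are labelled by the number of active splits; the new letter has multiplicity suc m.
offspring : ℕ → ℕ → List ℕ
offspring zero    N = replicate N (suc N)
offspring (suc m) N = map (_+ (2 + m)) (applyDownFrom suc N)

-- The root label 1 counts the sole split of the empty word. Letters enter in decreasing order, so
-- the multiplicity of the smallest one is used at the last level.
tree : ∀ k → (Fin k → ℕ) → List ℕ
tree zero    μ = 1 ∷ []
tree (suc k) μ = concatMap (offspring (pred (μ zero))) (tree k (μ ∘ suc))

-- `good-⊆` makes deletion of the smallest letter stay in the class, and `good-child` with
-- `decompose` makes insertion at active splits its inverse. The right-hand side of `succession`
-- mentions neither words nor patterns, which is why any two schemes give equal counts.
record Scheme (patterns : List Word) : Set₁ where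
  field
    Good        : Word → Set
    good⇔avoids : ∀ {w} → Good w ⇔ AvoidsAll patterns w
    good-[]     : Good []
    good-⊆      : ∀ {v w} → v ⊆ w → Good w → Good v

    Active    : Split → Set
    active?   : Decidable Active
    active-[] : Active ([] , [])

    insertion : Insertion

  open Insertion insertion public

  children : ℕ → ℕ → Word → List Word
  children c m w = map (child c m) (filter active? (splits w))

  field
    good-child : ∀ {c m u v} → Above c u → Above c v → Good (u ++ v) → Active (u , v) →
                 Good (child c m (u , v))
    decompose  : ∀ {c m w} → All (c ≤_) w → occurrences c w ≡ suc m → Good w →
                 ∃₂ λ u v → Above c u × Above c v × Active (u , v) × w ≡ child c m (u , v)
    succession : ∀ {c w} m → Above c w →
                 map (activeSites active?) (children c m w) ↭ offspring m (activeSites active? w)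

-- The offset `b` lets the recursion remove the smallest letter `suc b` without renaming the others.
-- At `b = 0` this unfolds to `IsMultipermutation`.
IsArrangement : ∀ b k → (Fin k → ℕ) → Word → Set
IsArrangement b k μ w =
  All (λ x → b < x × x ≤ b + k) w × (∀ i → occurrences (suc (b + toℕ i)) w ≡ μ i)

-- The words generated by a scheme

module Generation {patterns} (𝒮 : Scheme patterns) where
  open Scheme 𝒮

  generate : ∀ b k → (Fin k → ℕ) → List Word
  generate b zero    μ = [] ∷ []
  generate b (suc k) μ = concatMap (children (suc b) (pred (μ zero))) (generate (suc b) k (μ ∘ suc))

  ∈-children⁻ : ∀ {c m w y} → y ∈ children c m w →
                ∃₂ λ u v → u ++ v ≡ w × Active (u , v) × y ≡ child c m (u , v)
  ∈-children⁻ {w = w} y∈ with (u , v) , s∈ , y≡ ← ∈-map⁻ _ y∈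
                         with s∈splits , active ← ∈-filter⁻ active? {xs = splits w} s∈ =
    u , v , ∈-splits⁻ w s∈splits , active , y≡

  ∈-children⁺ : ∀ {c m u v} → Active (u , v) → child c m (u , v) ∈ children c m (u ++ v)
  ∈-children⁺ {u = u} {v} active = ∈-map⁺ _ (∈-filter⁺ active? (∈-splits⁺ u v) active)

  generate-sound : ∀ b k μ → (∀ i → 1 ≤ μ i) → ∀ {w} → w ∈ generate b k μ → IsArrangement b k μ w × Good w
  generate-sound b zero    μ μ≥1 (here refl) = ([] , λ ()) , good-[]
  generate-sound b (suc k) μ μ≥1 w∈
    with w′ , w′∈ , w∈children ← find (∈-concatMap⁻ _ {xs = generate (suc b) k (μ ∘ suc)} w∈)
    with (range , occ) , good ← generate-sound (suc b) k (μ ∘ suc) (μ≥1 ∘ suc) w′∈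
    with u , v , refl , active , refl ← ∈-children⁻ {w = w′} w∈children =
    (range′ , occ′) , good-child above-u above-v good active
    where
    c m : ℕ
    c = suc b
    m = pred (μ zero)
    InRange′ : ℕ → Set
    InRange′ x = b < x × x ≤ b + suc k
    above = above-split {u = u} (All.map proj₁ range) refl
    above-u = proj₁ above
    above-v = proj₂ above
    widen : ∀ {x} → c < x × x ≤ c + k → InRange′ x
    widen (c<x , x≤) = <-trans ≤-refl c<x , ≤-trans x≤ (≤-reflexive (sym (+-suc b k)))
    ranges = All.++⁻ u (All.map {Q = InRange′} widen range)
    c∈ : InRange′ c
    c∈ = ≤-refl , ≤-trans (s≤s (m≤m+n b k)) (≤-reflexive (sym (+-suc b k)))
    range′ = All.++⁺ (proj₁ ranges) (c∈ ∷ All-rest m c∈ (proj₂ ranges))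
    occ′ : ∀ i → occurrences (suc (b + toℕ i)) (child c m (u , v)) ≡ μ i
    occ′ zero rewrite +-identityʳ b =
      trans (occurrences-child m above-u above-v) (suc-pred (μ zero) {{>-nonZero (μ≥1 zero)}})
    -- Letters other than `c` are counted in the parent, which is recovered by deleting `c`.
    occ′ (suc i) rewrite +-suc b (toℕ i) = begin
      occurrences x (child c m (u , v))             ≡⟨ occurrences-delete c≢x (child c m (u , v)) ⟨
      occurrences x (delete c (child c m (u , v)))  ≡⟨ cong (occurrences x) (delete-child m above-u above-v) ⟩
      occurrences x (u ++ v)                        ≡⟨ occ i ⟩
      μ (suc i)                                     ∎
      where open ≡-Reasoning
            x = suc (suc (b + toℕ i))
            c≢x : c ≢ x
            c≢x = <⇒≢ (s≤s (s≤s (m≤m+n b (toℕ i))))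

  -- Deleting the smallest letter gives a smaller good arrangement, generated by induction;
  -- `decompose` exhibits the word as a child of it.
  generate-complete : ∀ b k μ → (∀ i → 1 ≤ μ i) → ∀ {w} → IsArrangement b k μ w → Good w → w ∈ generate b k μ
  generate-complete b zero    μ μ≥1 {[]} _ _ = here refl
  generate-complete b zero    μ μ≥1 {x ∷ _} ((b<x , x≤) ∷ _ , _) _ =
    contradiction (≤-trans x≤ (≤-reflexive (+-identityʳ b))) (<⇒≱ b<x)
  generate-complete b (suc k) μ μ≥1 {w} (range , occ) good =
    insert (decompose (All.map proj₁ range) occ-c good)
    where
    c : ℕ
    c = suc b
    occ-c : occurrences c w ≡ suc (pred (μ zero))
    occ-c = trans (cong (λ d → occurrences (suc d) w) (sym (+-identityʳ b)))
            (trans (occ zero) (sym (suc-pred (μ zero) {{>-nonZero (μ≥1 zero)}})))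
    arrangement : IsArrangement c k (μ ∘ suc) (delete c w)
    arrangement =
        All.zip (above-delete (All.map proj₁ range) ,
                 All-delete c (All.map (λ (_ , x≤) → ≤-trans x≤ (≤-reflexive (+-suc b k))) range))
      , λ i → trans (occurrences-delete (<⇒≢ (s≤s (s≤s (m≤m+n b (toℕ i))))) w)
                    (trans (cong (λ d → occurrences (suc d) w) (sym (+-suc b (toℕ i)))) (occ (suc i)))
    delete∈ : delete c w ∈ generate c k (μ ∘ suc)
    delete∈ = generate-complete c k (μ ∘ suc) (μ≥1 ∘ suc) arrangement (good-⊆ (filter-⊆ (other? c) w) good)
    insert : (∃₂ λ u v → Above c u × Above c v × Active (u , v) × w ≡ child c (pred (μ zero)) (u , v)) →
             w ∈ generate b (suc k) μ
    insert (u , v , above-u , above-v , active , w≡) = ∈-concatMap⁺ _ (lose delete∈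
      (subst₂ (λ y w′ → y ∈ children c (pred (μ zero)) w′) (sym w≡)
        (sym (trans (cong (delete c) w≡) (delete-child _ above-u above-v)))
        (∈-children⁺ active)))

  generate-above : ∀ b k μ → (∀ i → 1 ≤ μ i) → All (Above b) (generate b k μ)
  generate-above b k μ μ≥1 = All.tabulate (λ w∈ → All.map proj₁ (proj₁ (proj₁ (generate-sound b k μ μ≥1 w∈))))

  children-unique : ∀ {c w} m → Above c w → Unique (children c m w)
  children-unique {c} {w} m above = Unique-map injective (Unique.filter⁺ active? (splits-unique w))
    where
    injective : ∀ {s t} → s ∈ filter active? (splits w) → t ∈ filter active? (splits w) →
                child c m s ≡ child c m t → s ≡ t
    injective {u , v} {u′ , v′} s∈ t∈ eq = cong₂ _,_ u≡u′
      (++-cancelˡ u v v′ (trans uv≡w (trans (sym uv′≡w) (cong (_++ v′) (sym u≡u′)))))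
      where
      uv≡w  = ∈-splits⁻ w (proj₁ (∈-filter⁻ active? {xs = splits w} s∈))
      uv′≡w = ∈-splits⁻ w (proj₁ (∈-filter⁻ active? {xs = splits w} t∈))
      u≡u′  = split-at-first (proj₁ (above-split above uv≡w)) (proj₁ (above-split above uv′≡w)) eq

  delete-children : ∀ {c w} m → Above c w → All (λ y → delete c y ≡ w) (children c m w)
  delete-children {c} {w} m above = All.tabulate parent
    where
    parent : ∀ {y} → y ∈ children c m w → delete c y ≡ w
    parent y∈ with u , v , refl , _ , refl ← ∈-children⁻ {w = w} y∈
              with above-u , above-v ← above-split {u = u} above refl = delete-child m above-u above-v

  generate-unique : ∀ b k μ → (∀ i → 1 ≤ μ i) → Unique (generate b k μ)
  generate-unique b zero    μ μ≥1 = [] ∷ []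
  generate-unique b (suc k) μ μ≥1 =
    Unique-concatMap (delete (suc b)) (generate-unique (suc b) k (μ ∘ suc) (μ≥1 ∘ suc))
      (All.map (children-unique _) above) (All.map (delete-children _) above)
    where above = generate-above (suc b) k (μ ∘ suc) (μ≥1 ∘ suc)

  generate-tree : ∀ b k μ → (∀ i → 1 ≤ μ i) → map (activeSites active?) (generate b k μ) ↭ tree k μ
  generate-tree b zero    μ μ≥1 = ↭-reflexive (cong (_∷ []) (count-all active? (active-[] ∷ [])))
  generate-tree b (suc k) μ μ≥1 = begin
    map E (concatMap (children c m) ws)
      ≡⟨ map-concatMap E (children c m) ws ⟩
    concatMap (map E ∘ children c m) ws
      ↭⟨ concatMap-↭ (All.map (succession m) (generate-above c k (μ ∘ suc) (μ≥1 ∘ suc))) ⟩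
    concatMap (offspring m ∘ E) ws
      ≡⟨ concatMap-map (offspring m) E ws ⟨
    concatMap (offspring m) (map E ws)
      -- The inductive hypothesis gives the labels only up to order; `concatMap` respects equality
      -- as bags.
      ↭⟨ ∼bag⇒↭ (>>=-cong (↭⇒∼bag (generate-tree c k (μ ∘ suc) (μ≥1 ∘ suc))) (λ _ → ↔-refl)) ⟩
    concatMap (offspring m) (tree k (μ ∘ suc)) ∎
    where
    open PermutationReasoning
    c = suc b
    m = pred (μ zero)
    E = activeSites active?
    ws = generate c k (μ ∘ suc)

  av-tree : ∀ S → av S patterns ≡ length (tree (Multiset.k S) (Multiset.mult S))
  av-tree S = begin
    length (avoiders S patterns)
      -- Two duplicate-free lists with the same members are permutations of each other.
      ≡⟨ ↭-length (∼bag⇒↭ (unique∧set⇒bag (avoiders-unique S patterns) (generate-unique 0 k mult mult≥1) same)) ⟩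
    length (generate 0 k mult)
      ≡⟨ length-map _ (generate 0 k mult) ⟨
    length (map (activeSites active?) (generate 0 k mult))
      ≡⟨ ↭-length (generate-tree 0 k mult mult≥1) ⟩
    length (tree k mult) ∎
    where
    open ≡-Reasoning
    open Multiset S
    same : ∀ {w} → w ∈ avoiders S patterns ⇔ w ∈ generate 0 k mult
    same {w} = mk⇔
      (λ w∈ → let arr , avoids = Equivalence.to (∈-avoiders S patterns w) w∈
              in generate-complete 0 k mult mult≥1 arr (Equivalence.from good⇔avoids avoids))
      (λ w∈ → let arr , good = generate-sound 0 k mult mult≥1 w∈
              in Equivalence.from (∈-avoiders S patterns w) (arr , Equivalence.to good⇔avoids good))

equivalent : ∀ {P Q} → Scheme P → Scheme Q → P ∼ Q
equivalent 𝒮 𝒯 S = trans (Generation.av-tree 𝒮 S) (sym (Generation.av-tree 𝒯 S))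

-- Sublists and the smallest letter

above⇒∉ : ∀ {c u} → Above c u → c ∉ u
above⇒∉ above c∈u = <-irrefl refl (All.lookup above c∈u)

∉-replicate : ∀ {c y} m → c < y → y ∉ replicate m c
∉-replicate m c<y y∈ = <-irrefl (sym (All.lookup (All.replicate⁺ {P = _≡ _} m refl) y∈)) c<y

skip : ∀ {x : ℕ} {t u s} → x ∉ u → x ∷ t ⊆ u ++ s → x ∷ t ⊆ s
skip {u = []}    _   sub        = sub
skip {u = _ ∷ _} x∉u (_ ∷ʳ sub) = skip (x∉u ∘ there) sub
skip {u = _ ∷ _} x∉u (refl ∷ _) = contradiction (here refl) x∉u

after-first : ∀ {c : ℕ} {t u s} → c ∉ u → c ∷ t ⊆ u ++ c ∷ s → t ⊆ s
after-first c∉u sub = ∷⁻ (skip c∉u sub)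

-- As `y` is not `c`, it is matched in `u` or in `s`. In the former case the next `c` may be taken
-- to be the first one, so `t` fits into `s`.
around-first : ∀ {c y : ℕ} {t u s} → c ∉ u → c < y → y ∷ c ∷ t ⊆ u ++ c ∷ s → y ∈ u × t ⊆ s ⊎ y ∷ c ∷ t ⊆ s
around-first {u = []}    _   c<y (_ ∷ʳ sub)   = inj₂ sub
around-first {u = []}    _   c<y (refl ∷ _)   = contradiction c<y (<-irrefl refl)
around-first {u = _ ∷ _} c∉u c<y (refl ∷ sub) = inj₁ (here refl , after-first (c∉u ∘ there) sub)
around-first {u = _ ∷ _} c∉u c<y (_ ∷ʳ sub) with around-first (c∉u ∘ there) c<y sub
... | inj₁ (y∈u , sub′) = inj₁ (there y∈u , sub′)
... | inj₂ sub′         = inj₂ sub′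

delete-⊆ : ∀ c w → delete c w ⊆ w
delete-⊆ c w = filter-⊆ (other? c) w

⊆-delete : ∀ {c t w} → Above c t → t ⊆ w → t ⊆ delete c w
⊆-delete {c} {w = w} above sub =
  subst (_⊆ delete c w) (delete-above above) (⊆-filter⁺ (other? c) (other? c) (λ { refl p → p }) sub)

≤-split : ∀ {c x} → c ≤ x → x ≡ c ⊎ c < x
≤-split c≤x with m≤n⇒m<n∨m≡n c≤x
... | inj₁ c<x  = inj₂ c<x
... | inj₂ refl = inj₁ refl

-- `fst∈` and `snd∈` confine the search for an occurrence to letters of the word, which makes
-- freeness decidable; `above` lets an occurrence survive the deletion of a smaller letter.
record Shape₂ (p : ℕ → ℕ → Word) : Set where
  field
    fst∈  : ∀ {x y} → x ∈ p x y
    snd∈  : ∀ {x y} → y ∈ p x y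
    above : ∀ {c x y} → c < x → x < y → Above c (p x y)

module _ {p : ℕ → ℕ → Word} (shape : Shape₂ p) where
  open Shape₂ shape

  free₂? : Decidable (Free₂ p)
  free₂? w = map′
    (λ h x<y sub → All.lookup (All.lookup h (∈-resp-⊆ sub fst∈)) (∈-resp-⊆ sub snd∈) x<y sub)
    (λ free → All.tabulate (λ _ → All.tabulate (λ _ → free)))
    (All.all? (λ x → All.all? (λ y → (x <? y) →-dec ¬? (p x y ⊆? w)) w) w)

  -- An occurrence whose least letter exceeds `c` avoids `c` altogether and survives deletion. Only
  -- occurrences with `c` as least letter need an argument.
  free₂-delete⁻ : ∀ {c w} → All (c ≤_) w → (∀ {y} → c < y → ¬ (p c y ⊆ w)) →
                  Free₂ p (delete c w) → Free₂ p w
  free₂-delete⁻ ≥c none free x<y sub with ≤-split (All.lookup ≥c (∈-resp-⊆ sub fst∈))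
  ... | inj₁ refl = none x<y sub
  ... | inj₂ c<x  = free x<y (⊆-delete (above c<x x<y) sub)

free₃-delete⁻ : ∀ {p : ℕ → ℕ → ℕ → Word} → (∀ {x y z} → x ∈ p x y z) →
                (∀ {c x y z} → c < x → x < y → y < z → Above c (p x y z)) →
                ∀ {c w} → All (c ≤_) w → (∀ {y z} → c < y → y < z → ¬ (p c y z ⊆ w)) →
                Free₃ p (delete c w) → Free₃ p w
free₃-delete⁻ fst∈ above ≥c none free x<y y<z sub with ≤-split (All.lookup ≥c (∈-resp-⊆ sub fst∈))
... | inj₁ refl = none x<y y<z sub
... | inj₂ c<x  = free x<y y<z (⊆-delete (above c<x x<y y<z) sub)

free₂-⊆ : ∀ {p v w} → v ⊆ w → Free₂ p w → Free₂ p v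
free₂-⊆ v⊆w free x<y sub = free x<y (⊆-trans sub v⊆w)

free₃-⊆ : ∀ {p v w} → v ⊆ w → Free₃ p w → Free₃ p v
free₃-⊆ v⊆w free x<y y<z sub = free x<y y<z (⊆-trans sub v⊆w)

-- Placing the copies of the smallest letter

first-occurrence : ∀ {c m w} → All (c ≤_) w → occurrences c w ≡ suc m →
                   ∃₂ λ u s → w ≡ u ++ c ∷ s × Above c u × All (c ≤_) s × occurrences c s ≡ m
first-occurrence {c} {w = x ∷ w} (c≤x ∷ ≥c) occ with ≤-split c≤x
... | inj₁ refl = [] , w , refl , [] , ≥c , suc-injective (trans (sym (occurrences-here c w)) occ) 
... | inj₂ c<x with first-occurrence ≥c (trans (sym (occurrences-there (<⇒≢ c<x) w)) occ)
...   | u , s , refl , above , rest = x ∷ u , s , refl , c<x ∷ above , rest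

-- Once a larger letter has been met, `none` bars every further `c`.
first-block : ∀ {c} m s → All (c ≤_) s → occurrences c s ≡ m → (∀ {y} → c < y → ¬ (y ∷ c ∷ [] ⊆ s)) →
              ∃ λ v → s ≡ replicate m c ++ v × Above c v
first-block m []      []          refl none = [] , refl , []
first-block {c} m (x ∷ s) (c≤x ∷ ≥c) occ none with ≤-split c≤x
... | inj₁ refl with v , s≡ , above ← first-block (occurrences c s) s ≥c refl (λ c<y sub → none c<y (c ∷ʳ sub)) =
  v , trans (cong (c ∷_) s≡) (cong (λ n → replicate n c ++ v) (trans (sym (occurrences-here c s)) occ)) , above
... | inj₂ c<x = x ∷ s , cong (λ n → replicate n c ++ x ∷ s) (trans (sym (occurrences-above above)) occ) , above
  where
  above : Above c (x ∷ s)
  above = c<x ∷ All.tabulate λ {y} y∈s →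
    [ (λ { refl → contradiction (refl ∷ from∈ y∈s) (none c<x) }) , id ]′ (≤-split (All.lookup ≥c y∈s))

constant : ∀ {c} {s : Word} → All (_≡ c) s → s ≡ replicate (length s) c
constant []         = refl
constant (refl ∷ e) = cong (_ ∷_) (constant e)

-- Once a `c` has been met, `none` bars every larger letter, so the remainder is constant.
last-block : ∀ {c} m s → All (c ≤_) s → occurrences c s ≡ m → (∀ {y} → c < y → ¬ (c ∷ y ∷ [] ⊆ s)) →
             ∃ λ v → s ≡ v ++ replicate m c × Above c v
last-block m []      []          refl none = [] , refl , []
last-block {c} m (x ∷ s) (c≤x ∷ ≥c) occ none with ≤-split c≤x
... | inj₂ c<x with v , s≡ , above ← last-block m s ≥c (trans (sym (occurrences-there (<⇒≢ c<x) s)) occ)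
                                       (λ c<y sub → none c<y (x ∷ʳ sub)) =
  x ∷ v , cong (x ∷_) s≡ , c<x ∷ above
... | inj₁ refl = [] , trans s≡ (cong (λ n → replicate n c) length≡) , []
  where
  s≡ : c ∷ s ≡ replicate (suc (length s)) c
  s≡ = constant (refl ∷ All.tabulate λ {y} y∈s →
    [ id , (λ c<y → contradiction (refl ∷ from∈ y∈s) (none c<y)) ]′ (≤-split (All.lookup ≥c y∈s)))
  length≡ : suc (length s) ≡ m
  length≡ = trans (sym (occurrences-replicate c (suc (length s)))) (trans (cong (occurrences c) (sym s≡)) occ)

blockFirst blockLast : ℕ → ℕ → Word → Word
blockFirst c m v = replicate m c ++ v
blockLast  c m v = v ++ replicate m c

module _ {P : Pred ℕ ℓ} {c : ℕ} {v : Word} where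

  All-blockFirst : ∀ m → P c → All P v → All P (blockFirst c m v)
  All-blockFirst m pc pv = All.++⁺ (All.replicate⁺ m pc) pv

  All-blockLast : ∀ m → P c → All P v → All P (blockLast c m v)
  All-blockLast m pc pv = All.++⁺ pv (All.replicate⁺ m pc)

module _ {c : ℕ} {v : Word} where

  delete-blockFirst : ∀ m → Above c v → delete c (blockFirst c m v) ≡ v
  delete-blockFirst m above = trans (delete-++ c (replicate m c) v)
    (cong₂ _++_ (delete-replicate c m) (delete-above above))

  delete-blockLast : ∀ m → Above c v → delete c (blockLast c m v) ≡ v
  delete-blockLast m above = trans (delete-++ c v (replicate m c))
    (trans (cong₂ _++_ (delete-above above) (delete-replicate c m)) (++-identityʳ v))

  occurrences-blockFirst : ∀ m → Above c v → occurrences c (blockFirst c m v) ≡ m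
  occurrences-blockFirst m above = trans (occurrences-++ c (replicate m c) v)
    (trans (cong₂ _+_ (occurrences-replicate c m) (occurrences-above above)) (+-identityʳ m))

  occurrences-blockLast : ∀ m → Above c v → occurrences c (blockLast c m v) ≡ m
  occurrences-blockLast m above = trans (occurrences-++ c v (replicate m c))
    (cong₂ _+_ (occurrences-above above) (occurrences-replicate c m))

firstBlock lastBlock : Insertion
firstBlock = record
  { rest             = blockFirst
  ; All-rest         = All-blockFirst
  ; delete-rest      = delete-blockFirst
  ; occurrences-rest = occurrences-blockFirst
  }
lastBlock = record
  { rest             = blockLast
  ; All-rest         = All-blockLast
  ; delete-rest      = delete-blockLast
  ; occurrences-rest = occurrences-blockLast
  }

-- Counting the active sites of a child

module _ {P : Pred Split ℓ} (P? : Decidable P) where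

  activeSites-∷ : ∀ u c s → activeSites P? (u ++ c ∷ s) ≡
                  count P? (map (before (c ∷ s)) (splits u)) + count P? (map (after (u ++ c ∷ [])) (splits s))
  activeSites-∷ u c s = trans (cong (count P?) (splits-++-∷ u c s)) (count-++ P? (map (before (c ∷ s)) (splits u)) _)

  -- The last two hypotheses say that the new `c` does not affect activity on either side. Then the
  -- child has the active cuts of the parent, with the active junction counted twice.
  activeSites-single : ∀ {c} u v → P (u , v) →
    (∀ p q → p ++ q ≡ u → P (p , q ++ c ∷ v) ⇔ P (p , q ++ v)) →
    (∀ p q → p ++ q ≡ v → P ((u ++ c ∷ []) ++ p , q) ⇔ P (u ++ p , q)) →
    activeSites P? (u ++ c ∷ v) ≡ suc (activeSites P? (u ++ v))
  activeSites-single {c} u v active left right = begin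
    activeSites P? (u ++ c ∷ v)
      ≡⟨ activeSites-∷ u c v ⟩
    count P? (map (before (c ∷ v)) (splits u)) + count P? (map (after (u ++ c ∷ [])) (splits v))
      ≡⟨ cong₂ _+_ (count-map-cong P? (splits-All u left)) (count-map-cong P? (splits-All v right)) ⟩
    count P? (map (before v) (splits u)) + count P? (map (after u) (splits v))
      ≡⟨ count-++ P? (map (before v) (splits u)) _ ⟨
    count P? (map (before v) (splits u) ++ map (after u) (splits v))
      ≡⟨ count-↭ P? (splits-junction u v) ⟩
    count P? ((u , v) ∷ splits (u ++ v))
      ≡⟨ cong length (filter-accept P? active) ⟩
    suc (activeSites P? (u ++ v)) ∎
    where open ≡-Reasoning

  offspring-single : ∀ {w} (child : Split → Word) →
    (∀ u v → u ++ v ≡ w → P (u , v) → activeSites P? (child (u , v)) ≡ suc (activeSites P? (u ++ v))) →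
    map (activeSites P?) (map child (filter P? (splits w))) ↭ offspring 0 (activeSites P? w)
  offspring-single {w} child single = ↭-reflexive (trans (sym (map-∘ (filter P? (splits w))))
    (map-constant (All.tabulate λ {(u , v)} s∈ → 
      let s∈splits , active = ∈-filter⁻ P? {xs = splits w} s∈
          uv≡w = ∈-splits⁻ w s∈splits
      in trans (single u v uv≡w active) (cong (suc ∘ activeSites P?) uv≡w))))

  -- The summand `2 + m` is the multiplicity of the new letter; the class-specific part is a `rank`
  -- taking each value from 1 to N once on the active splits.
  offspring-block : ∀ {w} (child : Split → Word) (rank : Split → ℕ) m →
    (∀ u v → u ++ v ≡ w → P (u , v) → activeSites P? (child (u , v)) ≡ rank (u , v) + (2 + m)) →
    map rank (filter P? (splits w)) ↭ applyDownFrom suc (activeSites P? w) →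
    map (activeSites P?) (map child (filter P? (splits w))) ↭ offspring (suc m) (activeSites P? w)
  offspring-block {w} child rank m block ranks = begin
    map (activeSites P?) (map child F)  ≡⟨ map-∘ F ⟨
    map (activeSites P? ∘ child) F      ≡⟨ map-cong-local (All.tabulate λ {(u , v)} s∈ →
                                             let s∈splits , active = ∈-filter⁻ P? {xs = splits w} s∈
                                             in block u v (∈-splits⁻ w s∈splits) active) ⟩
    map (λ s → rank s + (2 + m)) F      ≡⟨ map-∘ F ⟩
    map (_+ (2 + m)) (map rank F)       ↭⟨ map⁺ _ ranks ⟩
    offspring (suc m) (activeSites P? w) ∎
    where
    open PermutationReasoning
    F = filter P? (splits w)

-- Suffix-determined activity

delete-single : ∀ {c} q v → Above c q → Above c v → delete c (q ++ c ∷ v) ≡ q ++ v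
delete-single {c} q v above-q above-v = trans (delete-++ c q (c ∷ v))
  (cong₂ _++_ (delete-above above-q) (trans (delete-∷ c v) (delete-above above-v)))

≥-single : ∀ {c} q v → Above c q → Above c v → All (c ≤_) (q ++ c ∷ v)
≥-single q v above-q above-v = All.++⁺ (All.map <⇒≤ above-q) (≤-refl ∷ All.map <⇒≤ above-v)

module _ {p : ℕ → ℕ → Word} (shape : Shape₂ p) where

  SuffixFree : Split → Set
  SuffixFree s = Free₂ p (proj₂ s)

  suffixFree? : Decidable SuffixFree
  suffixFree? s = free₂? shape (proj₂ s)

  free-tail : ∀ {x w} → Free₂ p (x ∷ w) → Free₂ p w
  free-tail {x} = free₂-⊆ (x ∷ʳ ⊆-refl)

  -- The hypothesis on `p` holds for 211 and 121 because both repeat their least letter.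
  suffix-single : ∀ {c w} → Above c w →
    (∀ {y q v} → c < y → Above c q → Above c v → ¬ (p c y ⊆ q ++ c ∷ v)) →
    ∀ u v → u ++ v ≡ w → SuffixFree (u , v) →
    activeSites suffixFree? (u ++ c ∷ v) ≡ suc (activeSites suffixFree? (u ++ v))
  suffix-single {c} above none u v refl active = activeSites-single suffixFree? u v active
    (λ { r q refl → let above-q = proj₂ (above-split {u = r} above-u refl) in mk⇔
      (free₂-⊆ (⊆-++⁺ (⊆-refl {x = q}) (c ∷ʳ ⊆-refl)))
      (λ free → free₂-delete⁻ shape (≥-single q v above-q above-v)
        (λ c<y → none c<y above-q above-v)
        (subst (Free₂ p) (sym (delete-single q v above-q above-v)) free)) })
    (λ r q _ → mk⇔ id id)
    where
    above-u = proj₁ (above-split {u = u} above refl)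
    above-v = proj₂ (above-split {u = u} above refl)

  count-suffixes : ∀ u s → Free₂ p s →
                   count suffixFree? (map (after u) (splits s)) ≡ suc (length s)
  count-suffixes u s free = trans (count-map suffixFree? (after u) (splits s))
    (trans (count-all suffixFree? (all-active (free₂? shape) free-tail s free)) (length-splits s))

211-shape : Shape₂ (λ x y → y ∷ x ∷ x ∷ [])
211-shape = record
  { fst∈  = there (here refl)
  ; snd∈  = here refl
  ; above = λ c<x x<y → <-trans c<x x<y ∷ c<x ∷ c<x ∷ []
  }

121-shape : Shape₂ (λ x y → x ∷ y ∷ x ∷ [])
121-shape = record
  { fst∈  = here refl
  ; snd∈  = there (here refl)
  ; above = λ c<x x<y → c<x ∷ <-trans c<x x<y ∷ c<x ∷ []
  }

112-shape : Shape₂ (λ x y → x ∷ x ∷ y ∷ [])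
112-shape = record
  { fst∈  = here refl
  ; snd∈  = there (there (here refl))
  ; above = λ c<x x<y → c<x ∷ c<x ∷ <-trans c<x x<y ∷ []
  }

∷⊈above : ∀ {c v t} → Above c v → ¬ (c ∷ t ⊆ v)
∷⊈above above sub = above⇒∉ above (∈-resp-⊆ sub (here refl))

∷⊈replicate : ∀ {c y t} m → c < y → ¬ (y ∷ t ⊆ replicate m c)
∷⊈replicate m c<y sub = ∉-replicate m c<y (∈-resp-⊆ sub (here refl))

-- The scheme of {121, 1322}

module Scheme-121-1322 where

  211? = free₂? 211-shape
  Active = SuffixFree 211-shape
  active? = suffixFree? 211-shape

  open Insertion firstBlock

  Good : Word → Set
  Good w = 121-free w × 1322-free w

  good-child : ∀ {c m u v} → Above c u → Above c v → Good (u ++ v) → Active (u , v) → Good (child c m (u , v))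
  good-child {c} {m} {u} {v} above-u above-v (free , free′) active =
      free₂-delete⁻ 121-shape ≥c
        -- In `c y c` the larger `y` comes after the block, and no `c` follows it there.
        (λ c<y sub → ∷⊈above above-v (∷ˡ⁻ (skip (∉-replicate m c<y) (after-first c∉u sub))))
        (subst 121-free (sym delete≡) free)
    , free₃-delete⁻ (here refl)
        (λ c<x x<y y<z → c<x ∷ <-trans (<-trans c<x x<y) y<z ∷ <-trans c<x x<y ∷ <-trans c<x x<y ∷ []) ≥c
        -- With `c` as the 1 of 1322, the remaining 322 lies in `v` and is a 211.
        (λ c<y y<z sub → active y<z (skip (∉-replicate m (<-trans c<y y<z)) (after-first c∉u sub)))
        (subst 1322-free (sym delete≡) free′)
    where
    ≥c      = child-≥ m above-u above-v
    delete≡ = delete-child m above-u above-v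
    c∉u     = above⇒∉ above-u

  decompose : ∀ {c m w} → All (c ≤_) w → occurrences c w ≡ suc m → Good w →
              ∃₂ λ u v → Above c u × Above c v × Active (u , v) × w ≡ child c m (u , v)
  decompose {c} {m} ≥c occ (free , free′)
    with u , s , refl , above-u , ≥c′ , occ′ ← first-occurrence ≥c occ
    with v , refl , above-v ← first-block m s ≥c′ occ′ (λ c<y sub → free c<y (++⁺ˡ u (refl ∷ sub))) =
    u , v , above-u , above-v ,
    (λ y<z sub → free′ (All.lookup above-v (∈-resp-⊆ sub (there (here refl)))) y<z
                       (++⁺ˡ u (refl ∷ ++⁺ˡ (replicate m c) sub))) ,
    refl

  -- Any letter of `u` left in the suffix precedes two copies of `c` and forms a 211, so only the
  -- cut after all of `u` remains.
  count-before : ∀ {c} u s → Above c u → Free₂ (λ x y → y ∷ x ∷ x ∷ []) (c ∷ c ∷ s) →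
                 count active? (map (before (c ∷ c ∷ s)) (splits u)) ≡ 1
  count-before {c} []      s []            free = count-all active? {xs = ([] , c ∷ c ∷ s) ∷ []} (free ∷ [])
  count-before {c} (x ∷ u) s (c<x ∷ above) free = begin
    count active? (([] , x ∷ u ++ c ∷ c ∷ s) ∷ map (before (c ∷ c ∷ s)) (map (map₁ (x ∷_)) (splits u)))
      ≡⟨ cong length (filter-reject active? (λ free′ → free′ c<x (refl ∷ ++⁺ˡ u (refl ∷ refl ∷ minimum s)))) ⟩
    count active? (map (before (c ∷ c ∷ s)) (map (map₁ (x ∷_)) (splits u)))
      ≡⟨ cong (count active?) (trans (sym (map-∘ (splits u))) (map-∘ (splits u))) ⟩
    count active? (map (map₁ (x ∷_)) (map (before (c ∷ c ∷ s)) (splits u)))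
      ≡⟨ count-map active? (map₁ (x ∷_)) (map (before (c ∷ c ∷ s)) (splits u)) ⟩
    count active? (map (before (c ∷ c ∷ s)) (splits u))
      ≡⟨ count-before u s above free ⟩
    1 ∎
    where open ≡-Reasoning

  activeSites-block : ∀ {c w} m → Above c w → ∀ u v → u ++ v ≡ w → Active (u , v) →
                      activeSites active? (child c (suc m) (u , v)) ≡ suc (length v) + (2 + m)
  activeSites-block {c} m above u v refl active = begin
    activeSites active? (u ++ c ∷ s)
      ≡⟨ activeSites-∷ active? u c s ⟩
    count active? (map (before (c ∷ s)) (splits u)) + count active? (map (after (u ++ c ∷ [])) (splits s))
      ≡⟨ cong₂ _+_ (count-before u (blockFirst c m v) above-u (free (2 + m)))
                   (count-suffixes 211-shape _ s (free (suc m))) ⟩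
    2 + length s
      ≡⟨ cong (2 +_) (trans (length-++ (replicate (suc m) c)) (cong (_+ length v) (length-replicate (suc m)))) ⟩
    2 + (suc m + length v)
      ≡⟨ +-comm (2 + suc m) (length v) ⟩
    length v + (2 + suc m)
      ≡⟨ +-suc (length v) (2 + m) ⟩
    suc (length v) + (2 + m) ∎
    where
    open ≡-Reasoning
    s = blockFirst c (suc m) v
    above-u = proj₁ (above-split {u = u} above refl)
    above-v = proj₂ (above-split {u = u} above refl)
    -- The pattern 211 begins with its largest letter, which exceeds `c`; an occurrence therefore
    -- starts beyond the block and lies in `v`.
    free : ∀ n → Free₂ (λ x y → y ∷ x ∷ x ∷ []) (replicate n c ++ v)
    free n x<y sub = active x<y (skip (∉-replicate n (≤-<-trans c≤x x<y)) sub)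
      where c≤x = All.lookup (All-blockFirst {v = v} n ≤-refl (All.map <⇒≤ above-v))
                             (∈-resp-⊆ sub (there (here refl)))

  succession : ∀ {c w} m → Above c w →
               map (activeSites active?) (map (child c m) (filter active? (splits w))) ↭
               offspring m (activeSites active? w)
  succession {c} zero    above = offspring-single active? (child c zero)
    (suffix-single 211-shape above λ c<y above-q above-v sub →
      ∷⊈above above-v (after-first (above⇒∉ above-q) (∷ˡ⁻ sub)))
  succession {c} {w} (suc m) above = offspring-block active? (child c (suc m)) (suc ∘ length ∘ proj₂) m
    (activeSites-block m above)
    (↭-reflexive (trans (map-∘ (filter active? (splits w)))
      (trans (cong (map suc) (suffixLengths 211? (free-tail 211-shape) w))
             (map-downFrom suc _))))

  scheme : Scheme ((1 ∷ 2 ∷ 1 ∷ []) ∷ (1 ∷ 3 ∷ 2 ∷ 2 ∷ []) ∷ [])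
  scheme = record
    { Good        = Good
    ; good⇔avoids = mk⇔
        (λ (free , free′) → free⇒avoids-121 free ∷ free⇒avoids-1322 free′ ∷ [])
        (λ { (avoids ∷ avoids′ ∷ []) → avoids⇒free₂ _ avoids , avoids⇒free₃ _ avoids′ })
    ; good-[]     = (λ _ ()) , (λ _ _ ())
    ; good-⊆      = λ v⊆w (free , free′) → free₂-⊆ v⊆w free , free₃-⊆ v⊆w free′
    ; Active      = Active
    ; active?     = active?
    ; active-[]   = λ _ ()
    ; insertion   = firstBlock
    ; good-child  = good-child
    ; decompose   = decompose
    ; succession  = succession
    }

-- Words free of 112

module LastBlock where

  open Insertion lastBlock

  112-free-child : ∀ {c u v} m → Above c u → Above c v → 112-free (u ++ v) → 112-free (child c m (u , v))
  112-free-child m above-u above-v free =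
    free₂-delete⁻ 112-shape (child-≥ m above-u above-v)
      -- In `c c y` the second `c` is already among the final copies, after which nothing larger
      -- occurs.
      (λ c<y sub → ∷⊈replicate m c<y (∷ˡ⁻ (skip (above⇒∉ above-v) (after-first (above⇒∉ above-u) sub))))
      (subst 112-free (sym (delete-child m above-u above-v)) free)

  112-free-decompose : ∀ {c m w} → All (c ≤_) w → occurrences c w ≡ suc m → 112-free w →
                       ∃₂ λ u v → Above c u × Above c v × w ≡ child c m (u , v)
  112-free-decompose {c} {m} ≥c occ free
    with u , s , refl , above-u , ≥c′ , occ′ ← first-occurrence ≥c occ
    with v , refl , above-v ← last-block m s ≥c′ occ′ (λ c<y sub → free c<y (++⁺ˡ u (refl ∷ sub))) =
    u , v , above-u , above-v , refl

-- The scheme of {112, 1232}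

module Scheme-112-1232 where

  open Insertion lastBlock
  open LastBlock

  121? = free₂? 121-shape
  Active = SuffixFree 121-shape
  active? = suffixFree? 121-shape

  Good : Word → Set
  Good w = 112-free w × 1232-free w

  good-child : ∀ {c m u v} → Above c u → Above c v → Good (u ++ v) → Active (u , v) → Good (child c m (u , v))
  good-child {c} {m} {u} {v} above-u above-v (free , free′) active =
      112-free-child m above-u above-v free
    , free₃-delete⁻ (here refl)
        (λ c<x x<y y<z → c<x ∷ <-trans c<x x<y ∷ <-trans (<-trans c<x x<y) y<z ∷ <-trans c<x x<y ∷ [])
        (child-≥ m above-u above-v)
        -- With `c` as the 1 of 1232, the remaining 232 follows the first `c`; its letters exceed
        -- `c`, so it is a 121 within `v`.
        (λ c<y y<z sub → active y<z (subst (_ ⊆_) (delete-rest m above-v)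
          (⊆-delete (c<y ∷ <-trans c<y y<z ∷ c<y ∷ []) (after-first (above⇒∉ above-u) sub))))
        (subst 1232-free (sym (delete-child m above-u above-v)) free′)

  decompose : ∀ {c m w} → All (c ≤_) w → occurrences c w ≡ suc m → Good w →
              ∃₂ λ u v → Above c u × Above c v × Active (u , v) × w ≡ child c m (u , v)
  decompose ≥c occ (free , free′)
    with u , v , above-u , above-v , refl ← 112-free-decompose ≥c occ free =
    u , v , above-u , above-v ,
    (λ y<z sub → free′ (All.lookup above-v (∈-resp-⊆ sub (here refl))) y<z
                       (++⁺ˡ u (refl ∷ ++⁺ʳ _ sub))) ,
    refl

  -- Inserting at the very end keeps all N active splits; otherwise only those of v survive.
  rank : ℕ → ℕ → ℕ
  rank N zero    = N
  rank N (suc j) = suc j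

  -- The entry 0, last in `downFrom N`, receives the top value N and moves to the front; every other
  -- entry is kept.
  rank-downFrom : ∀ N → map (rank N) (downFrom N) ↭ applyDownFrom suc N
  rank-downFrom zero    = ↭-refl
  rank-downFrom (suc n) = begin
    map (rank (suc n)) (downFrom (suc n))
      ≡⟨ cong (map _) (downFrom-∷ʳ n) ⟨
    map (rank (suc n)) (applyDownFrom suc n ++ 0 ∷ [])
      ≡⟨ map-++ _ (applyDownFrom suc n) _ ⟩
    map (rank (suc n)) (applyDownFrom suc n) ++ suc n ∷ []
      ≡⟨ cong (_++ suc n ∷ []) (map-applyDownFrom suc (rank (suc n)) n) ⟩
    applyDownFrom suc n ++ suc n ∷ []
      ↭⟨ ∷↭∷ʳ (suc n) (applyDownFrom suc n) ⟨
    applyDownFrom suc (suc n) ∎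
    where open PermutationReasoning

  -- A 121 with least letter `c` would need a larger letter after a `c`, and here only copies of `c`
  -- follow.
  free-blockLast : ∀ {c} n v → Above c v → Free₂ (λ x y → x ∷ y ∷ x ∷ []) v →
                   Free₂ (λ x y → x ∷ y ∷ x ∷ []) (blockLast c n v)
  free-blockLast n v above free = free₂-delete⁻ 121-shape (All-blockLast n ≤-refl (All.map <⇒≤ above))
    (λ c<y sub → ∷⊈replicate n c<y (∷ˡ⁻ (skip (above⇒∉ above) sub)))
    (subst (Free₂ _) (sym (delete-blockLast n above)) free)

  activeSites-block : ∀ {c w} m → Above c w → ∀ u v → u ++ v ≡ w → Active (u , v) →
                      activeSites active? (child c (suc m) (u , v)) ≡ rank (activeSites active? w) (length v) + (2 + m)
  activeSites-block {c} m above u [] refl active = begin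
    activeSites active? (u ++ c ∷ s)
      ≡⟨ activeSites-∷ active? u c s ⟩
    count active? (map (before (c ∷ s)) (splits u)) + count active? (map (after (u ++ c ∷ [])) (splits s))
      ≡⟨ cong₂ _+_ left (count-suffixes 121-shape _ s (free-blockLast (suc m) [] [] active)) ⟩
    activeSites active? (u ++ []) + suc (length s)
      ≡⟨ cong (λ n → activeSites active? (u ++ []) + suc n) (length-replicate (suc m)) ⟩
    activeSites active? (u ++ []) + (2 + m) ∎
    where
    open ≡-Reasoning
    s = replicate (suc m) c
    left : count active? (map (before (c ∷ s)) (splits u)) ≡ activeSites active? (u ++ [])
    left = begin
      count active? (map (before (c ∷ s)) (splits u))
        ≡⟨ count-map-cong active? (splits-All u λ { r q refl →
             let above-q = proj₂ (above-split {u = r} (proj₁ (above-split {u = r ++ q} above refl)) refl)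
             in mk⇔ (free₂-⊆ (++⁺ʳ _ ⊆-refl)) (free-blockLast (2 + m) q above-q) }) ⟩
      count active? (map id (splits u))
        ≡⟨ cong (count active?) (map-id (splits u)) ⟩
      activeSites active? u
        ≡⟨ cong (activeSites active?) (++-identityʳ u) ⟨
      activeSites active? (u ++ []) ∎
  activeSites-block {c} m above u v@(y ∷ v′) refl active = begin
    activeSites active? (u ++ c ∷ s)
      ≡⟨ activeSites-∷ active? u c s ⟩
    count active? (map (before (c ∷ s)) (splits u)) + count active? (map (after (u ++ c ∷ [])) (splits s))
      ≡⟨ cong₂ _+_ left (count-suffixes 121-shape _ s (free-blockLast (suc m) v above-v active)) ⟩
    suc (length s)
      ≡⟨ cong suc (trans (length-++ v) (cong (length v +_) (length-replicate (suc m)))) ⟩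
    suc (length v + suc m)
      ≡⟨ +-suc (length v) (suc m) ⟨
    length v + (2 + m) ∎
    where
    open ≡-Reasoning
    s = blockLast c (suc m) v
    above-v = proj₂ (above-split {u = u} above refl)
    -- Every such suffix contains the first `c`, the letter `y` and a final `c`, which form a 121.
    left : count active? (map (before (c ∷ s)) (splits u)) ≡ 0
    left = count-none active? (All.map⁺ (splits-All u λ r q _ free →
      free (All.head above-v) (++⁺ˡ q (refl ∷ refl ∷ ++⁺ˡ v′ (refl ∷ minimum _)))))

  succession : ∀ {c w} m → Above c w →
               map (activeSites active?) (map (child c m) (filter active? (splits w))) ↭
               offspring m (activeSites active? w)
  succession {c} zero above = offspring-single active? (child c zero) λ u v uv≡w active →
    trans (cong (λ s → activeSites active? (u ++ c ∷ s)) (++-identityʳ v))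
      (suffix-single 121-shape above
        (λ c<y above-q above-v sub → ∷⊈above above-v (∷ˡ⁻ (after-first (above⇒∉ above-q) sub)))
        u v uv≡w active)
  succession {c} {w} (suc m) above = offspring-block active? (child c (suc m)) (rank _ ∘ length ∘ proj₂) m
    (activeSites-block m above)
    (↭-trans (↭-reflexive (trans (map-∘ (filter active? (splits w)))
        (cong (map _) (suffixLengths 121? (free-tail 121-shape) w))))
      (rank-downFrom _))

  scheme : Scheme ((1 ∷ 1 ∷ 2 ∷ []) ∷ (1 ∷ 2 ∷ 3 ∷ 2 ∷ []) ∷ [])
  scheme = record
    { Good        = Good
    ; good⇔avoids = mk⇔
        (λ (free , free′) → free⇒avoids-112 free ∷ free⇒avoids-1232 free′ ∷ [])
        (λ { (avoids ∷ avoids′ ∷ []) → avoids⇒free₂ _ avoids , avoids⇒free₃ _ avoids′ })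
    ; good-[]     = (λ _ ()) , (λ _ _ ())
    ; good-⊆      = λ v⊆w (free , free′) → free₂-⊆ v⊆w free , free₃-⊆ v⊆w free′
    ; Active      = Active
    ; active?     = active?
    ; active-[]   = λ _ ()
    ; insertion   = lastBlock
    ; good-child  = good-child
    ; decompose   = decompose
    ; succession  = succession
    }

-- The scheme of {112, 2132}

module Scheme-112-2132 where

  open Insertion lastBlock
  open LastBlock

  -- Here `x` plays the 2 and `y` the 3 of 2132, with the 1 to be inserted at the cut.
  Active : Split → Set
  Active (u , v) = ∀ {x y} → x ∈ u → x < y → ¬ (y ∷ x ∷ [] ⊆ v)

  active? : Decidable Active
  active? (u , v) = map′
    (λ h x∈u x<y sub → All.lookup (All.lookup h x∈u) (∈-resp-⊆ sub (here refl)) x<y sub)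
    (λ active → All.tabulate (λ x∈u → All.tabulate (λ _ → active x∈u)))
    (All.all? (λ x → All.all? (λ y → (x <? y) →-dec ¬? (y ∷ x ∷ [] ⊆? v)) v) u)

  Good : Word → Set
  Good w = 112-free w × 2132-free w

  good-child : ∀ {c m u v} → Above c u → Above c v → Good (u ++ v) → Active (u , v) → Good (child c m (u , v))
  good-child {c} {m} {u} {v} above-u above-v (free , free′) active =
      112-free-child m above-u above-v free
    , free₃-delete⁻ (there (here refl))
        (λ c<x x<y y<z → <-trans c<x x<y ∷ c<x ∷ <-trans (<-trans c<x x<y) y<z ∷ <-trans c<x x<y ∷ [])
        (child-≥ m above-u above-v)
        no-least
        (subst 2132-free (sym (delete-child m above-u above-v)) free′)
    where
    no-least : ∀ {y z} → c < y → y < z → ¬ (y ∷ c ∷ z ∷ y ∷ [] ⊆ child c m (u , v))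
    -- Either `y` precedes the first `c`, and then `z y` in `v` contradicts activity, or the `c` of
    -- the occurrence is a final copy and cannot be followed by `z`.
    no-least c<y y<z sub with around-first (above⇒∉ above-u) c<y sub
    ... | inj₁ (y∈u , sub′) = active y∈u y<z (subst (_ ⊆_) (delete-rest m above-v)
                                (⊆-delete (<-trans c<y y<z ∷ c<y ∷ []) sub′))
    ... | inj₂ sub′         = ∷⊈replicate m (<-trans c<y y<z) (∷ˡ⁻ (skip (above⇒∉ above-v) (∷ˡ⁻ sub′)))

  decompose : ∀ {c m w} → All (c ≤_) w → occurrences c w ≡ suc m → Good w →
              ∃₂ λ u v → Above c u × Above c v × Active (u , v) × w ≡ child c m (u , v)
  decompose ≥c occ (free , free′)
    with u , v , above-u , above-v , refl ← 112-free-decompose ≥c occ free =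
    u , v , above-u , above-v ,
    (λ x∈u x<y sub → free′ (All.lookup above-u x∈u) x<y
                           (⊆-++⁺ (from∈ x∈u) (refl ∷ ++⁺ʳ _ sub))) ,
    refl

  -- All letters of `u` exceed `c`, so a forbidden pair in the suffix consists of letters larger
  -- than `c`.
  active-delete : ∀ {c u} s → Above c u → Active (u , s) ⇔ Active (u , delete c s)
  active-delete {c} {u} s above = mk⇔ to from
    where
    to : Active (u , s) → Active (u , delete c s)
    to active x∈u x<y sub = active x∈u x<y (⊆-trans sub (delete-⊆ c s))
    from : Active (u , delete c s) → Active (u , s)
    from active x∈u x<y sub = active x∈u x<y (⊆-delete (<-trans c<x x<y ∷ c<x ∷ []) sub)
      where c<x = All.lookup above x∈u

  active-left : ∀ {c u v} m → Above c u → Above c v → ∀ p q → p ++ q ≡ u →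
                Active (p , q ++ c ∷ blockLast c m v) ⇔ Active (p , q ++ v)
  active-left {c} {v = v} m above-u above-v p q refl with above-p , above-q ← above-split {u = p} above-u refl =
    subst (λ s → Active (p , q ++ c ∷ blockLast c m v) ⇔ Active (p , s))
      (delete-child {u = q} m above-q above-v) (active-delete _ above-p)

  -- The new `c` in the prefix could matter only through another `c` in the suffix, and there is
  -- none.
  active-single : ∀ {c u v} → Above c v → ∀ p q → p ++ q ≡ v →
                  Active ((u ++ c ∷ []) ++ p , q) ⇔ Active (u ++ p , q)
  active-single {c} {u} above-v p q refl = mk⇔ to from
    where
    above-q = proj₂ (above-split {u = p} above-v refl)
    to : Active ((u ++ c ∷ []) ++ p , q) → Active (u ++ p , q)
    to active x∈ = active (∈-resp-⊆ (⊆-++⁺ (++⁺ʳ (c ∷ []) (⊆-refl {x = u})) (⊆-refl {x = p})) x∈)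
    from : Active (u ++ p , q) → Active ((u ++ c ∷ []) ++ p , q)
    from active x∈ x<y sub with ∈-++⁻ (u ++ c ∷ []) x∈
    ... | inj₂ x∈p = active (∈-++⁺ʳ u x∈p) x<y sub
    ... | inj₁ x∈uc with ∈-++⁻ u x∈uc
    ...   | inj₁ x∈u         = active (∈-++⁺ˡ x∈u) x<y sub
    ...   | inj₂ (here refl) = ∷⊈above above-q (∷ˡ⁻ sub)

  active-replicate : ∀ u n {c} → Active (u , replicate n c)
  active-replicate u n {c} _ x<y sub with refl ∷ refl ∷ [] ← All-resp-⊆ sub (All.replicate⁺ {P = _≡ c} n refl) =
    <-irrefl refl x<y

  -- With `c` in the prefix, no larger letter may precede a `c` in the suffix. The cut must
  -- therefore pass all of `v`, which leaves the `2 + m` cuts of the final `suc m` copies.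
  count-right : ∀ {c} m u v → c ∈ u → Above c v →
                count active? (map (after u) (splits (blockLast c (suc m) v))) ≡ 2 + m
  count-right {c} m u [] c∈u above = begin
    count active? (map (after u) (splits (replicate (suc m) c)))
      ≡⟨ count-all active? (All.map⁺ (splits-All (replicate (suc m) c) suffix-active)) ⟩
    length (map (after u) (splits (replicate (suc m) c)))
      ≡⟨ trans (length-map _ (splits (replicate (suc m) c))) (length-splits (replicate (suc m) c)) ⟩
    suc (length (replicate (suc m) c))
      ≡⟨ cong suc (length-replicate (suc m)) ⟩
    2 + m ∎
    where
    open ≡-Reasoning
    suffix-active : ∀ p q → p ++ q ≡ replicate (suc m) c → Active (u ++ p , q)
    suffix-active p q eq x∈ x<y sub = active-replicate (u ++ p) (suc m) {c} x∈ x<y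
      (subst (_ ⊆_) eq (++⁺ˡ p sub))
  count-right {c} m u (x ∷ v) c∈u (c<x ∷ above) = begin
    count active? ((u ++ [] , x ∷ s) ∷ map (after u) (map (map₁ (x ∷_)) (splits s)))
      ≡⟨ cong length (filter-reject active? (λ active → active (∈-++⁺ˡ c∈u) c<x
           (refl ∷ ++⁺ˡ v (refl ∷ minimum _)))) ⟩
    count active? (map (after u) (map (map₁ (x ∷_)) (splits s)))
      ≡⟨ cong (count active?) (map-∘ (splits s)) ⟨
    count active? (map (after u ∘ map₁ (x ∷_)) (splits s))
      ≡⟨ cong (count active?) (map-cong (λ (p , q) → cong (_, q) (sym (++-assoc u (x ∷ []) p))) (splits s)) ⟩
    count active? (map (after (u ++ x ∷ [])) (splits s))
      ≡⟨ count-right m (u ++ x ∷ []) v (∈-++⁺ˡ c∈u) above ⟩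
    2 + m ∎
    where
    open ≡-Reasoning
    s = blockLast c (suc m) v

  activeSites-block : ∀ {c w} m → Above c w → ∀ u v → u ++ v ≡ w → Active (u , v) →
                      activeSites active? (child c (suc m) (u , v)) ≡ leftRank active? (u , v) + (2 + m)
  activeSites-block {c} m above u v refl _ with above-u , above-v ← above-split {u = u} above refl =
    trans (activeSites-∷ active? u c (blockLast c (suc m) v))
      (cong₂ _+_ (count-map-cong active? (splits-All u (active-left (suc m) above-u above-v)))
                 (count-right m (u ++ c ∷ []) v (∈-++⁺ʳ u (here refl)) above-v))

  succession : ∀ {c w} m → Above c w →
               map (activeSites active?) (map (child c m) (filter active? (splits w))) ↭
               offspring m (activeSites active? w)
  succession {c} {w} zero above = offspring-single active? {w} (child c zero) λ { u v refl active →
    let above-u , above-v = above-split {u = u} above refl in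
    trans (cong (λ s → activeSites active? (u ++ c ∷ s)) (++-identityʳ v))
      (activeSites-single active? u v active
        (λ p q pq≡u → subst (λ s → Active (p , q ++ c ∷ s) ⇔ Active (p , q ++ v)) (++-identityʳ v)
                            (active-left 0 above-u above-v p q pq≡u))
        (active-single {u = u} above-v)) }
  succession {c} {w} (suc m) above = offspring-block active? {w} (child c (suc m)) (leftRank active?) m
    (activeSites-block m above)
    -- Ranks increase from left to right, whereas `offspring` lists its labels decreasingly.
    (↭-trans (↭-reflexive (trans (leftRanks active? w) (sym (reverse-applyDownFrom suc (activeSites active? w)))))
             (↭-reverse (applyDownFrom suc (activeSites active? w))))

  scheme : Scheme ((1 ∷ 1 ∷ 2 ∷ []) ∷ (2 ∷ 1 ∷ 3 ∷ 2 ∷ []) ∷ [])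
  scheme = record
    { Good        = Good
    ; good⇔avoids = mk⇔
        (λ (free , free′) → free⇒avoids-112 free ∷ free⇒avoids-2132 free′ ∷ [])
        (λ { (avoids ∷ avoids′ ∷ []) → avoids⇒free₂ _ avoids , avoids⇒free₃ _ avoids′ })
    ; good-[]     = (λ _ ()) , (λ _ _ ())
    ; good-⊆      = λ v⊆w (free , free′) → free₂-⊆ v⊆w free , free₃-⊆ v⊆w free′
    ; Active      = Active
    ; active?     = active?
    ; active-[]   = λ ()
    ; insertion   = lastBlock
    ; good-child  = good-child
    ; decompose   = decompose
    ; succession  = succession
    }

theorem2p15 :
  let P = (1 ∷ 2 ∷ 1 ∷ []) ∷ (1 ∷ 3 ∷ 2 ∷ 2 ∷ []) ∷ []
      Q = (1 ∷ 1 ∷ 2 ∷ []) ∷ (1 ∷ 2 ∷ 3 ∷ 2 ∷ []) ∷ []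
      R = (1 ∷ 1 ∷ 2 ∷ []) ∷ (2 ∷ 1 ∷ 3 ∷ 2 ∷ []) ∷ []
  in (P ∼ Q) × (Q ∼ R) × (P ∼ R)
theorem2p15 =
    equivalent Scheme-121-1322.scheme Scheme-112-1232.scheme
  , equivalent Scheme-112-1232.scheme Scheme-112-2132.scheme
  , equivalent Scheme-121-1322.scheme Scheme-112-2132.scheme
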